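{- Let $p\ge 0$ be an integer, let $G$ be a minimal forbidden interval subgraph for the class of $p$-improper interval graphs, and let $\alpha$ be a minimal representation of $G$. Let $H$ be an unconfined, non-exterior side component of $G$ (with respect to $\alpha$). Then $H$ consists of a clique that is of maximal order among all interior potential blocking sets of $G$ (with respect to $\alpha$).
   Context: All graphs are finite and simple. An interval graph is a graph $G=(V,E)$ having a representation $\alpha: v\mapsto I_v$ by intervals of the real line such that, for distinct $v,w$, $vw\in E$ if and only if $I_v\cap I_w\neq\emptyset$. $G$ is $p$-improper if it has a representation in which no interval properly contains more than $p$ other intervals. The impropriety $\mathrm{imp}(G)$ is the smallest $p$ such that $G$ is $p$-improper. A representation is minimal if the maximum number of intervals properly contained in a single interval equals $\mathrm{imp}(G)$. A minimal forbidden interval subgraph for the class of $p$-improper interval graphs is an interval graph that is not $p$-improper but all of whose proper (induced) subgraphs are $p$-improper. A basepoint of $G$ is a vertex $z$ such that in every representation $I_z$ properly contains the intervals of at least $\mathrm{imp}(G)$ other vertices; "the basepoint" denotes this vertex $z$. The local components of $G$ are the connected components of $G\setminus\{z\}$; the support of a local component is the union of the intervals of its vertices. Given a representation, order the local components $H_0,\dots,H_m$ by their supports from left to right; $H_0$ and $H_m$ are the side components. A potential side component is a local component that is a side component in some representation. A vertex contributes to the impropriety of $G$ in a representation if its interval is properly contained in $I_z$. A side component is exterior if it contains at least one vertex at distance at least $2$ from $z$ (such a vertex is called an exterior vertex), and non-exterior otherwise. A potential side component $H$ is unconfined if there is a representation of $G$ in which $H$ contains no vertex that contributes to the impropriety of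 $G$; it is confined if in every representation it contains at least one such vertex. Given a representation, a blocking set of $G$ is a set of vertices that are adjacent to the basepoint $z$, whose intervals are not properly contained in $I_z$, and that are not adjacent to any exterior vertex of $G$ (it need not be an entire local component). A potential blocking set is a set of vertices of $G$ that can be made into a blocking set by changing the representation of $G$. Given a representation, an interior potential blocking set is a potential blocking set contained in a potential side component that is not an actual side component of that representation. -}

module Defs where

open import Level using (Level; 0ℓ; _⊔_) renaming (suc to lsuc)
open import Data.Nat.Base using (ℕ; zero; suc; _≤_; _<_)
open import Data.Fin.Base using (Fin)
open import Data.Fin.Subset using (Subset; _∈_; _⊆_; ∁; ⁅_⁆; ∣_∣; Nonempty)
open import Data.List.Base using (map; allFin)
open import Data.List.Extrema.Nat using (max)
open import Data.Product.Base using (_×_; _,_; ∃; ∃-syntax; Σ-syntax; proj₁; proj₂)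
open import Data.Sum.Base using (_⊎_)
open import Data.Vec.Base using (tabulate)
open import Function.Bundles using (_⇔_; _↣_; Injection)
open import Relation.Binary.Bundles using (DenseLinearOrder; DecTotalOrder)
open import Relation.Binary.Core using (Rel)
open import Relation.Binary.Construct.Closure.ReflexiveTransitive using (Star)
open import Relation.Binary.Definitions using (Decidable; Symmetric)
open import Relation.Binary.PropositionalEquality using (_≡_; _≢_)
import Relation.Binary.Properties.StrictTotalOrder as STO
open import Relation.Nullary using (¬_)
open import Relation.Nullary.Decidable using (does; map′; _×-dec_; ¬?)
open import Relation.Unary using (Pred)
import Relation.Unary as Unary

private
  variable
    c ℓ₁ ℓ₂ : Level

-- Interval representations use nothing of the real line but its order.  A `Line` is
-- any dense linear order (with trichotomy) without endpoints: classically ℝ is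
-- one, and so is ℚ.
record Line c ℓ₁ ℓ₂ : Set (lsuc (c ⊔ ℓ₁ ⊔ ℓ₂)) where
  field
    denseLinearOrder : DenseLinearOrder c ℓ₁ ℓ₂

  open DenseLinearOrder denseLinearOrder public
    using (Carrier; strictTotalOrder; dense)
    renaming (_≈_ to _≈ᴸ_; _<_ to _<ᴸ_)

  field
    noMinimum : ∀ x → ∃[ y ] y <ᴸ x
    noMaximum : ∀ x → ∃[ y ] x <ᴸ y

  open STO strictTotalOrder public using (decTotalOrder)
  open DecTotalOrder decTotalOrder public
    using () renaming (_≤_ to _≤ᴸ_; _≤?_ to _≤ᴸ?_; refl to ≤ᴸ-refl; trans to ≤ᴸ-trans)

record Graph : Set₁ where
  infix 4 _~_
  field
    order  : ℕ
    _~_    : Rel (Fin order) 0ℓ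
    _~?_   : Decidable _~_
    ~-sym  : Symmetric _~_
    ~-irr  : ∀ {v} → ¬ v ~ v

  Vertex : Set
  Vertex = Fin order

  VertexSet : Set
  VertexSet = Subset order

open Graph public using (Vertex; VertexSet)

induced : (G : Graph) {m : ℕ} → (Fin m ↣ Vertex G) → Graph
induced G {m} f = record
  { order = m
  ; _~_   = λ i j → to i ~ to j
  ; _~?_  = λ i j → to i ~? to j
  ; ~-sym = ~-sym
  ; ~-irr = ~-irr
  }
  where
  open Graph G
  open Injection f using (to)

module _ (G : Graph) where
  open Graph G using (_~_)

  data Walk : Vertex G → Vertex G → ℕ → Set where
    stay : ∀ {u} → Walk u u zero
    step : ∀ {u v w k} → u ~ v → Walk v w k → Walk u w (suc k)

  -- Vertices with no walk between them are at infinite distance.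
  Distance≥ : ℕ → Vertex G → Vertex G → Set
  Distance≥ d u v = ∀ {k} → Walk u v k → d ≤ k

  ConnectedWithin : VertexSet G → Rel (Vertex G) 0ℓ
  ConnectedWithin S = Star λ u v → u ∈ S × v ∈ S × u ~ v

  -- C is the vertex set of a connected component of the subgraph induced by S.
  IsComponentOf : VertexSet G → VertexSet G → Set
  IsComponentOf S C =
    Nonempty C × C ⊆ S × (∀ {u} → u ∈ C → ∀ w → w ∈ C ⇔ ConnectedWithin S u w)

  IsClique : VertexSet G → Set
  IsClique C = ∀ {u v} → u ∈ C → v ∈ C → u ≢ v → u ~ v

  IsLocalComponent : Vertex G → VertexSet G → Set
  IsLocalComponent z = IsComponentOf (∁ ⁅ z ⁆)

  IsExteriorVertex : Vertex G → Vertex G → Set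
  IsExteriorVertex z v = Distance≥ 2 z v

  IsExterior : Vertex G → VertexSet G → Set
  IsExterior z H = ∃[ v ] v ∈ H × IsExteriorVertex z v

-- n is the maximum of the orders of the members of 𝓕.  When 𝓕 has no member there is
-- no order to attain, and only the (vacuous) upper bound remains.
HasMaximalOrderAmong : ∀ {a k} → ℕ → Pred (Subset k) a → Set a
HasMaximalOrderAmong n 𝓕 =
  (∀ {B} → 𝓕 B → ∣ B ∣ ≤ n) × (∃ 𝓕 → ∃[ B ] 𝓕 B × ∣ B ∣ ≡ n)

module Impropriety (ℝ : Line c ℓ₁ ℓ₂) where
  open Line ℝ

  record Interval : Set (c ⊔ ℓ₁ ⊔ ℓ₂) where
    field
      lower upper : Carrier
      lower≤upper : lower ≤ᴸ upper

  open Interval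

  ⟦_⟧ : Interval → Pred Carrier (ℓ₁ ⊔ ℓ₂)
  ⟦ I ⟧ x = lower I ≤ᴸ x × x ≤ᴸ upper I

  _⊆ᴵ_ _⊂ᴵ_ _≬ᴵ_ : Rel Interval (c ⊔ ℓ₁ ⊔ ℓ₂)
  I ⊆ᴵ J = ⟦ I ⟧ Unary.⊆ ⟦ J ⟧
  I ⊂ᴵ J = ⟦ I ⟧ Unary.⊂ ⟦ J ⟧
  I ≬ᴵ J = ⟦ I ⟧ Unary.≬ ⟦ J ⟧

  _⊆ᴵ?_ : Decidable _⊆ᴵ_
  I ⊆ᴵ? J = map′
    (λ (p , q) (r , s) → ≤ᴸ-trans p r , ≤ᴸ-trans s q)
    (λ I⊆J → proj₁ (I⊆J (≤ᴸ-refl , lower≤upper I)) , proj₂ (I⊆J (lower≤upper I , ≤ᴸ-refl)))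
    ((lower J ≤ᴸ? lower I) ×-dec (upper I ≤ᴸ? upper J))

  _⊂ᴵ?_ : Decidable _⊂ᴵ_
  I ⊂ᴵ? J = (I ⊆ᴵ? J) ×-dec ¬? (J ⊆ᴵ? I)

  record Representation (G : Graph) : Set (c ⊔ ℓ₁ ⊔ ℓ₂) where
    open Graph G using (_~_)
    field
      interval   : Vertex G → Interval
      represents : ∀ {v w} → v ≢ w → v ~ w ⇔ (interval v ≬ᴵ interval w)

  open Representation public using (interval)

  IsIntervalGraph : Graph → Set (c ⊔ ℓ₁ ⊔ ℓ₂)
  IsIntervalGraph = Representation

  module _ {G : Graph} (α : Representation G) where

    contained : Vertex G → VertexSet G
    contained v = tabulate λ w → does (interval α w ⊂ᴵ? interval α v)

    maxContained : ℕ
    maxContained = max 0 (map (λ v → ∣ contained v ∣) (allFin _))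

  IsImproper : ℕ → Graph → Set (c ⊔ ℓ₁ ⊔ ℓ₂)
  IsImproper p G = Σ[ α ∈ Representation G ] (∀ v → ∣ contained α v ∣ ≤ p)

  -- imp(G) = q
  HasImpropriety : Graph → ℕ → Set (c ⊔ ℓ₁ ⊔ ℓ₂)
  HasImpropriety G q = IsImproper q G × (∀ r → IsImproper r G → q ≤ r)

  IsMinimalRepresentation : {G : Graph} → Representation G → Set (c ⊔ ℓ₁ ⊔ ℓ₂)
  IsMinimalRepresentation {G} α = HasImpropriety G (maxContained α)

  IsMinimalForbidden : ℕ → Graph → Set (c ⊔ ℓ₁ ⊔ ℓ₂)
  IsMinimalForbidden p G =
    IsIntervalGraph G ×
    ¬ IsImproper p G ×
    (∀ {m} (f : Fin m ↣ Vertex G) → m < Graph.order G → IsImproper p (induced G f))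

  IsBasepoint : (G : Graph) → Vertex G → Set (c ⊔ ℓ₁ ⊔ ℓ₂)
  IsBasepoint G z =
    ∃[ q ] HasImpropriety G q × (∀ (α : Representation G) → q ≤ ∣ contained α z ∣)

  module _ (G : Graph) (z : Vertex G) where
    open Graph G using (_~_)

    module _ (α : Representation G) where

      support : VertexSet G → Pred Carrier (ℓ₁ ⊔ ℓ₂)
      support H x = ∃[ v ] v ∈ H × ⟦ interval α v ⟧ x

      _leftOf_ : Rel (VertexSet G) (c ⊔ ℓ₁ ⊔ ℓ₂)
      H leftOf K = ∀ {x y} → support H x → support K y → x <ᴸ y

      -- H is H₀, respectively Hₘ, in the left-to-right order H₀ , … , Hₘ.
      IsLeftmost IsRightmost : VertexSet G → Set (c ⊔ ℓ₁ ⊔ ℓ₂)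
      IsLeftmost  H = ∀ K → IsLocalComponent G z K → K ≢ H → H leftOf K
      IsRightmost H = ∀ K → IsLocalComponent G z K → K ≢ H → K leftOf H

      IsSideComponent : VertexSet G → Set (c ⊔ ℓ₁ ⊔ ℓ₂)
      IsSideComponent H = IsLocalComponent G z H × (IsLeftmost H ⊎ IsRightmost H)

      Contributes : Vertex G → Set (c ⊔ ℓ₁ ⊔ ℓ₂)
      Contributes v = interval α v ⊂ᴵ interval α z

      IsBlockingSet : VertexSet G → Set (c ⊔ ℓ₁ ⊔ ℓ₂)
      IsBlockingSet B = ∀ {v} → v ∈ B →
        v ~ z × ¬ Contributes v × (∀ {w} → IsExteriorVertex G z w → ¬ v ~ w)

    IsPotentialSideComponent : VertexSet G → Set (c ⊔ ℓ₁ ⊔ ℓ₂)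
    IsPotentialSideComponent H = Σ[ β ∈ Representation G ] IsSideComponent β H

    IsUnconfined : VertexSet G → Set (c ⊔ ℓ₁ ⊔ ℓ₂)
    IsUnconfined H =
      IsPotentialSideComponent H ×
      Σ[ β ∈ Representation G ] (∀ {v} → v ∈ H → ¬ Contributes β v)

    IsPotentialBlockingSet : VertexSet G → Set (c ⊔ ℓ₁ ⊔ ℓ₂)
    IsPotentialBlockingSet B = Σ[ β ∈ Representation G ] IsBlockingSet β B

    IsInteriorPotentialBlockingSet : Representation G → VertexSet G → Set (c ⊔ ℓ₁ ⊔ ℓ₂)
    IsInteriorPotentialBlockingSet α B =
      IsPotentialBlockingSet B ×
      (∃[ K ] IsPotentialSideComponent K × ¬ IsSideComponent α K × B ⊆ K)

{-# OPTIONS --safe #-}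
-- Only the order of the endpoints matters, so representations are handled as placements on ℕ.
-- Let q = imp(G) > p; every representation of G puts at least q intervals inside the
-- basepoint z, and α puts exactly q there.
--
-- Clique: take a representation where no vertex of H contributes.  Since q > 0 some other
-- vertex lies inside z, and the connected set H cannot jump over it, so all of H contains
-- the same endpoint of z.
--
-- Upper bound: let K be the local component containing an interior potential blocking set B.
-- Exchange H and K in α, with B protruding from z: the number of intervals inside z changes
-- by at most |H| − |B|, which must not be negative.
--
-- Attainment: delete some h ∈ H, and take a representation with at most p intervals inside z.
-- Let L and R be its leftmost and rightmost local components other than H.  If H protruded
-- on one side, then putting all of H in place of L (or R) and L (or R) inside z would
-- represent G with at most p intervals inside z.  So all of H∖h lies inside z, and the same
-- exchange for whichever of L, R is not a side component of α shows that at least |H| of its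
-- vertices protrude; any |H| of them are as required.
module Submission where

open import Defs
open import Data.Bool.Base using (true; false)
open import Data.Empty using (⊥-elim) renaming (⊥ to ⊥₀)
open import Data.Fin.Base using (Fin; zero; suc; punchIn; punchOut)
open import Data.Fin.Properties using (_≟_; any?; all?; punchIn-injective; punchIn-punchOut)
open import Data.Fin.Subset
open import Data.Fin.Subset.Properties
open import Data.List.Base using (map; allFin)
open import Data.List.Extrema.Nat using (max; xs≤max)
open import Data.List.Membership.Propositional.Properties using (∈-map⁺; ∈-allFin)
open import Data.List.Relation.Unary.All using (lookup)
open import Data.Nat.Base using (ℕ; zero; suc; _+_; _∸_; _≤_; _<_; z≤n; s≤s)
import Data.Nat.Properties as ℕ
open import Data.Product.Base using (_×_; _,_; ∃; ∃-syntax; Σ-syntax; proj₁; proj₂)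
open import Data.Sum.Base as Sum using (_⊎_; inj₁; inj₂; [_,_]′)
open import Data.Vec.Base using ([]; _∷_; tabulate; here; there)
open import Data.Vec.Properties using ([]=⇒lookup; lookup⇒[]=; lookup∘tabulate)
open import Function.Base using (_∘_; id; const)
open import Function.Bundles using (_⇔_; _↣_; mk⇔; mk↣; Equivalence; Injection)
open import Level using (Level; 0ℓ)
open import Relation.Binary.Construct.Closure.ReflexiveTransitive as Star using (Star; ε; _◅_; _◅◅_)
open import Relation.Binary.Bundles using (StrictTotalOrder)
open import Relation.Binary.Definitions using (tri<; tri≈; tri>)
open import Relation.Binary.PropositionalEquality
open import Relation.Nullary using (¬_; Dec; yes; no; contradiction)
open import Relation.Nullary.Decidable using (does; dec-true; decidable-stable; ¬?; _×-dec_; _→-dec_; _⊎-dec_)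
open import Relation.Unary using (Pred; U) renaming (Decidable to Decidable₁)

private
  variable
    ℓ : Level
    n : ℕ

-- Finite sets of vertices and their cardinalities.

module _ {P : Pred (Fin n) ℓ} (P? : Decidable₁ P) where

  -- Has the same shape as `contained`, so the two membership lemmas below also apply to
  -- `contained`.
  fromDec : Subset n
  fromDec = tabulate (does ∘ P?)

  ∈-fromDec⁺ : ∀ {v} → P v → v ∈ fromDec
  ∈-fromDec⁺ {v} Pv = lookup⇒[]= v fromDec (trans (lookup∘tabulate (does ∘ P?) v) (dec-true (P? v) Pv))

  ∈-fromDec⁻ : ∀ {v} → v ∈ fromDec → P v
  ∈-fromDec⁻ {v} v∈ with P? v | trans (sym (lookup∘tabulate (does ∘ P?) v)) ([]=⇒lookup v∈)
  ... | yes Pv | _ = Pv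
  ... | no  _  | ()

∣p∪q∣≤∣p∣+∣q∣ : (p q : Subset n) → ∣ p ∪ q ∣ ≤ ∣ p ∣ + ∣ q ∣
∣p∪q∣≤∣p∣+∣q∣ []          []          = z≤n
∣p∪q∣≤∣p∣+∣q∣ (true  ∷ p) (true  ∷ q) =
  s≤s (ℕ.≤-trans (∣p∪q∣≤∣p∣+∣q∣ p q) (ℕ.+-monoʳ-≤ ∣ p ∣ (ℕ.n≤1+n ∣ q ∣)))
∣p∪q∣≤∣p∣+∣q∣ (true  ∷ p) (false ∷ q) = s≤s (∣p∪q∣≤∣p∣+∣q∣ p q)
∣p∪q∣≤∣p∣+∣q∣ (false ∷ p) (true  ∷ q) =
  ℕ.≤-trans (s≤s (∣p∪q∣≤∣p∣+∣q∣ p q)) (ℕ.≤-reflexive (sym (ℕ.+-suc ∣ p ∣ ∣ q ∣)))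
∣p∪q∣≤∣p∣+∣q∣ (false ∷ p) (false ∷ q) = ∣p∪q∣≤∣p∣+∣q∣ p q

∣p∣≡∣p∩q∣+∣p∩∁q∣ : (p q : Subset n) → ∣ p ∣ ≡ ∣ p ∩ q ∣ + ∣ p ∩ ∁ q ∣
∣p∣≡∣p∩q∣+∣p∩∁q∣ []          []          = refl
∣p∣≡∣p∩q∣+∣p∩∁q∣ (true  ∷ p) (true  ∷ q) = cong suc (∣p∣≡∣p∩q∣+∣p∩∁q∣ p q)
∣p∣≡∣p∩q∣+∣p∩∁q∣ (true  ∷ p) (false ∷ q) =
  trans (cong suc (∣p∣≡∣p∩q∣+∣p∩∁q∣ p q)) (sym (ℕ.+-suc ∣ p ∩ q ∣ ∣ p ∩ ∁ q ∣))
∣p∣≡∣p∩q∣+∣p∩∁q∣ (false ∷ p) (true  ∷ q) = ∣p∣≡∣p∩q∣+∣p∩∁q∣ p q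
∣p∣≡∣p∩q∣+∣p∩∁q∣ (false ∷ p) (false ∷ q) = ∣p∣≡∣p∩q∣+∣p∩∁q∣ p q

disjoint⇒∣p∣+∣q∣≤∣r∣ : (p q r : Subset n) → p ⊆ r → q ⊆ r → (∀ {v} → v ∈ p → v ∉ q) →
                       ∣ p ∣ + ∣ q ∣ ≤ ∣ r ∣
disjoint⇒∣p∣+∣q∣≤∣r∣ p q r p⊆r q⊆r disjoint = begin
  ∣ p ∣ + ∣ q ∣              ≤⟨ ℕ.+-mono-≤
                                 (p⊆q⇒∣p∣≤∣q∣ λ v∈p → x∈p∩q⁺ (p⊆r v∈p , v∈p))
                                 (p⊆q⇒∣p∣≤∣q∣ λ v∈q → x∈p∩q⁺ (q⊆r v∈q , x∉p⇒x∈∁p λ v∈p → disjoint v∈p v∈q)) ⟩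
  ∣ r ∩ p ∣ + ∣ r ∩ ∁ p ∣    ≡⟨ ∣p∣≡∣p∩q∣+∣p∩∁q∣ r p ⟨
  ∣ r ∣                      ∎
  where open ℕ.≤-Reasoning

subsetOfSize : (p : Subset n) {k : ℕ} → k ≤ ∣ p ∣ → ∃[ q ] q ⊆ p × ∣ q ∣ ≡ k
subsetOfSize {n} p {zero} _ = ⊥ , ⊥-elim ∘ ∉⊥ , ∣⊥∣≡0 n
subsetOfSize (true ∷ p) {suc k} (s≤s k≤∣p∣) with subsetOfSize p k≤∣p∣
... | q , q⊆p , ∣q∣≡k = inside ∷ q , s⊆s q⊆p , cong suc ∣q∣≡k
subsetOfSize (false ∷ p) {suc k} k≤∣p∣ with subsetOfSize p k≤∣p∣
... | q , q⊆p , ∣q∣≡k = outside ∷ q , s⊆s q⊆p , ∣q∣≡k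

-- Carries a cardinality bound from the graph without `h` back to those vertex sets of the whole
-- graph that avoid `h`.
∣∣-punchIn : ∀ {m} (h : Fin (suc m)) (p : Subset (suc m)) (q : Subset m) → h ∉ p →
             (∀ i → punchIn h i ∈ p → i ∈ q) → ∣ p ∣ ≤ ∣ q ∣
∣∣-punchIn zero (true  ∷ p) q h∉p _ = contradiction here h∉p
∣∣-punchIn zero (false ∷ p) q _ p⇒q = p⊆q⇒∣p∣≤∣q∣ λ v∈p → p⇒q _ (there v∈p)
∣∣-punchIn (suc h) (s ∷ p) (t ∷ q) h∉p p⇒q
  with ∣∣-punchIn h p q (h∉p ∘ there) (λ i i∈p → drop-there (p⇒q (suc i) (there i∈p)))
∣∣-punchIn (suc h) (true  ∷ p) (true  ∷ q) _ _   | ih = s≤s ih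
∣∣-punchIn (suc h) (true  ∷ p) (false ∷ q) _ p⇒q | ih with p⇒q zero here
... | ()
∣∣-punchIn (suc h) (false ∷ p) (true  ∷ q) _ _   | ih = ℕ.m≤n⇒m≤1+n ih
∣∣-punchIn (suc h) (false ∷ p) (false ∷ q) _ _   | ih = ih

minimiser : {P : Pred (Fin n) ℓ} → Decidable₁ P → (f : Fin n → ℕ) → ∃ P →
            ∃[ v ] P v × (∀ w → P w → f v ≤ f w)
minimiser {P = P} P? f (v , Pv) = go (suc (f v)) v Pv ℕ.≤-refl
  where
  -- `k` is fuel: every improvement lowers `f` strictly, and `f v < k` excludes `k = 0`.
  go : ∀ k v → P v → f v < k → ∃[ v ] P v × (∀ w → P w → f v ≤ f w)
  go (suc k) v Pv (s≤s fv≤k) with any? (λ w → P? w ×-dec f w ℕ.<? f v)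
  ... | yes (w , Pw , fw<fv) = go k w Pw (ℕ.<-≤-trans fw<fv fv≤k)
  ... | no ∄ = v , Pv , λ w Pw → ℕ.≮⇒≥ λ fw<fv → ∄ (w , Pw , fw<fv)

-- Intervals with natural numbers as endpoints.

record Placement (n : ℕ) : Set where
  field
    l r     : Fin n → ℕ
    l≤r     : ∀ v → l v ≤ r v
    bound   : ℕ
    r≤bound : ∀ v → r v ≤ bound

  l≤bound : ∀ v → l v ≤ bound
  l≤bound v = ℕ.≤-trans (l≤r v) (r≤bound v)

open Placement

-- No endpoint exceeds `bound`, so truncated subtraction from it reverses the order of the
-- endpoints. Mirror images reduce right-hand cases to left-hand ones.
reflect : Placement n → Placement n
reflect ρ = record
  { l       = λ v → bound ρ ∸ r ρ v
  ; r       = λ v → bound ρ ∸ l ρ v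
  ; l≤r     = λ v → ℕ.∸-monoʳ-≤ (bound ρ) (l≤r ρ v)
  ; bound   = bound ρ
  ; r≤bound = λ v → ℕ.m∸n≤m (bound ρ) (l ρ v)
  }

Inside : Placement n → Fin n → Fin n → Set
Inside ρ v w = l ρ w ≤ l ρ v × r ρ v ≤ r ρ w × (l ρ w < l ρ v ⊎ r ρ v < r ρ w)

inside? : (ρ : Placement n) (v w : Fin n) → Dec (Inside ρ v w)
inside? ρ v w =
  l ρ w ℕ.≤? l ρ v ×-dec r ρ v ℕ.≤? r ρ w ×-dec (l ρ w ℕ.<? l ρ v ⊎-dec r ρ v ℕ.<? r ρ w)

Inside-irrefl : (ρ : Placement n) {v : Fin n} → ¬ Inside ρ v v
Inside-irrefl ρ (_ , _ , strict) = [ ℕ.<-irrefl refl , ℕ.<-irrefl refl ]′ strict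

insiders : Placement n → Fin n → Subset n
insiders ρ z = fromDec (λ v → inside? ρ v z)

module _ (ρ : Placement n) where

  reflect-before : ∀ {v w} → r ρ v < l ρ w → r (reflect ρ) w < l (reflect ρ) v
  reflect-before {v} {w} rv<lw = ℕ.∸-monoʳ-< rv<lw (l≤bound ρ w)

  reflect-before⁻ : ∀ {v w} → r (reflect ρ) w < l (reflect ρ) v → r ρ v < l ρ w
  reflect-before⁻ {v} {w} before = ℕ.≰⇒> λ lw≤rv →
    ℕ.<⇒≱ before (ℕ.∸-monoʳ-≤ (bound ρ) lw≤rv)

  Inside-reflect⁻ : ∀ {v w} → Inside (reflect ρ) v w → Inside ρ v w
  Inside-reflect⁻ {v} {w} (lw≤lv , rv≤rw , strict) =
    ℕ.∸-cancelʳ-≤ (l≤bound ρ w) rv≤rw ,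
    ℕ.∸-cancelʳ-≤ (r≤bound ρ v) lw≤lv ,
    Sum.swap (Sum.map strictly strictly strict)
    where
    strictly : ∀ {a b} → bound ρ ∸ a < bound ρ ∸ b → b < a
    strictly {a} {b} lt = ℕ.≰⇒> λ a≤b → ℕ.<⇒≱ lt (ℕ.∸-monoʳ-≤ (bound ρ) a≤b)

  Inside-reflect⁺ : ∀ {v w} → Inside ρ v w → Inside (reflect ρ) v w
  Inside-reflect⁺ {v} {w} (lw≤lv , rv≤rw , strict) =
    ℕ.∸-monoʳ-≤ (bound ρ) rv≤rw ,
    ℕ.∸-monoʳ-≤ (bound ρ) lw≤lv ,
    Sum.swap (Sum.map (λ lt → ℕ.∸-monoʳ-< lt (l≤bound ρ v)) (λ lt → ℕ.∸-monoʳ-< lt (r≤bound ρ w)) strict)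

  ∣insiders-reflect∣≤ : ∀ {z} → ∣ insiders (reflect ρ) z ∣ ≤ ∣ insiders ρ z ∣
  ∣insiders-reflect∣≤ {z} = p⊆q⇒∣p∣≤∣q∣
    (∈-fromDec⁺ (λ v → inside? ρ v z) ∘ Inside-reflect⁻ ∘ ∈-fromDec⁻ (λ v → inside? (reflect ρ) v z))

-- Restricted to `S` because placements are glued from pieces that are correct on some vertices
-- only, for instance on all but a deleted one. Intersection is `meet` applied to an edge in both
-- directions.
record Represents (G : Graph) (ρ : Placement (Graph.order G)) (S : Pred (Vertex G) 0ℓ) : Set where
  open Graph G using (_~_)
  field
    meet : ∀ {v w} → S v → S w → v ~ w → l ρ v ≤ r ρ w
    sep  : ∀ {v w} → S v → S w → v ≢ w → ¬ v ~ w → r ρ v < l ρ w ⊎ r ρ w < l ρ v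

open Represents

-- Local components and the points that they cannot cross.

module LocalComponents (G : Graph) (z : Vertex G) where
  open Graph G hiding (Vertex; VertexSet)

  private
    variable
      K L : VertexSet G

  ∈∁z : ∀ {v} → v ≢ z → v ∈ ∁ ⁅ z ⁆
  ∈∁z = x∉p⇒x∈∁p ∘ x≢y⇒x∉⁅y⁆

  LocalComponent : VertexSet G → Set
  LocalComponent = IsLocalComponent G z

  Edge : Vertex G → Vertex G → Set
  Edge u v = u ∈ ∁ ⁅ z ⁆ × v ∈ ∁ ⁅ z ⁆ × u ~ v

  Star⊆ : ∀ {u v} → u ∈ ∁ ⁅ z ⁆ → Star Edge u v → v ∈ ∁ ⁅ z ⁆
  Star⊆ u∈ ε = u∈
  Star⊆ _ ((_ , v∈ , _) ◅ rest) = Star⊆ v∈ rest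

  Edge-sym : ∀ {u v} → Edge u v → Edge v u
  Edge-sym (u∈ , v∈ , u~v) = v∈ , u∈ , ~-sym u~v

  -- The set grows from `v` along edges avoiding `z` until no such edge leaves it. The counter `k`
  -- bounds the number of vertices still to be added; at zero the set already contains every vertex.
  component : ∀ v → v ≢ z → ∃[ K ] LocalComponent K × v ∈ K
  component v v≢z = grow ⁅ v ⁆ order start (x∈⁅x⁆ v) (ℕ.m≤n+m order ∣ ⁅ v ⁆ ∣)
    where
    start : ∀ {w} → w ∈ ⁅ v ⁆ → Star Edge v w
    start w∈ rewrite x∈⁅y⁆⇒x≡y v w∈ = ε

    grow : ∀ C k → (∀ {w} → w ∈ C → Star Edge v w) → v ∈ C → order ≤ ∣ C ∣ + k →
           ∃[ K ] LocalComponent K × v ∈ K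
    grow C k reach v∈C order≤ with any? (λ u → any? (λ w →
      (u ∈? C) ×-dec ¬? (w ∈? C) ×-dec ¬? (w ≟ z) ×-dec (u ~? w)))
    ... | no closed = C , ((v , v∈C) , C⊆ , λ {u} u∈C w →
              mk⇔ (λ w∈C → Star.reverse Edge-sym (reach u∈C) ◅◅ reach w∈C) (stays u∈C)) , v∈C
      where
      C⊆ : C ⊆ ∁ ⁅ z ⁆
      C⊆ w∈C = Star⊆ (∈∁z v≢z) (reach w∈C)

      stays : ∀ {a b} → a ∈ C → Star Edge a b → b ∈ C
      stays a∈C ε = a∈C
      stays {a} a∈C (_◅_ {j = w} (_ , w∈ , a~w) rest) = stays (decidable-stable (w ∈? C) λ w∉C →
        closed (a , w , a∈C , w∉C , x∉⁅y⁆⇒x≢y (x∈∁p⇒x∉p w∈) , a~w)) rest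
    ... | yes (u , w , u∈C , w∉C , w≢z , u~w) with k
    ...   | zero = contradiction
              (subst (w ∈_) (sym (∣p∣≡n⇒p≡⊤ (ℕ.≤-antisym (∣p∣≤n C)
                (ℕ.≤-trans order≤ (ℕ.≤-reflexive (ℕ.+-identityʳ ∣ C ∣)))))) ∈⊤) w∉C
    ...   | suc k′ = grow (C ∪ ⁅ w ⁆) k′ reach′ (p⊆p∪q ⁅ w ⁆ v∈C) (begin
                order                      ≤⟨ order≤ ⟩
                ∣ C ∣ + suc k′             ≡⟨ ℕ.+-suc ∣ C ∣ k′ ⟩
                suc ∣ C ∣ + k′             ≤⟨ ℕ.+-monoˡ-≤ k′ (p⊂q⇒∣p∣<∣q∣
                                                (p⊆p∪q ⁅ w ⁆ , w , q⊆p∪q C ⁅ w ⁆ (x∈⁅x⁆ w) , w∉C)) ⟩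
                ∣ C ∪ ⁅ w ⁆ ∣ + k′         ∎)
      where
      open ℕ.≤-Reasoning
      reach′ : ∀ {x} → x ∈ C ∪ ⁅ w ⁆ → Star Edge v x
      reach′ x∈ with x∈p∪q⁻ C ⁅ w ⁆ x∈
      ... | inj₁ x∈C = reach x∈C
      ... | inj₂ x∈w rewrite x∈⁅y⁆⇒x≡y w x∈w = reach u∈C ◅◅ ((Star⊆ (∈∁z v≢z) (reach u∈C) , ∈∁z w≢z , u~w) ◅ ε)

  ∈⇒≢z : LocalComponent K → ∀ {v} → v ∈ K → v ≢ z
  ∈⇒≢z (_ , K⊆ , _) v∈K = x∉⁅y⁆⇒x≢y (x∈∁p⇒x∉p (K⊆ v∈K))

  z∉ : LocalComponent K → z ∉ K
  z∉ K-lc z∈K = ∈⇒≢z K-lc z∈K refl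

  closed : LocalComponent K → ∀ {u v} → u ∈ K → v ≢ z → u ~ v → v ∈ K
  closed (_ , K⊆ , conn) u∈K v≢z u~v = Equivalence.from (conn u∈K _) ((K⊆ u∈K , ∈∁z v≢z , u~v) ◅ ε)

  ≁-across : LocalComponent K → ∀ {u v} → u ∈ K → v ∉ K → v ≢ z → ¬ u ~ v
  ≁-across K-lc u∈K v∉K v≢z u~v = v∉K (closed K-lc u∈K v≢z u~v)

  meeting⇒⊆ : LocalComponent K → LocalComponent L → ∀ {t} → t ∈ K → t ∈ L → K ⊆ L
  meeting⇒⊆ (_ , _ , connK) (_ , _ , connL) t∈K t∈L {w} w∈K =
    Equivalence.from (connL t∈L w) (Equivalence.to (connK t∈K w) w∈K)

  ≢⇒disjoint : LocalComponent K → LocalComponent L → K ≢ L → ∀ {v} → v ∈ K → v ∉ L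
  ≢⇒disjoint K-lc L-lc K≢L v∈K v∈L =
    K≢L (⊆-antisym (meeting⇒⊆ K-lc L-lc v∈K v∈L) (meeting⇒⊆ L-lc K-lc v∈L v∈K))

  -- Induction along a walk: `closed` keeps the walk inside `K`, so `P` has to pass only along edges
  -- within `K`.
  spread : LocalComponent K → (P : Pred (Vertex G) 0ℓ) →
           (∀ {u v} → u ∈ K → v ∈ K → u ~ v → P u → P v) →
           ∀ {u w} → u ∈ K → w ∈ K → P u → P w
  spread {K} K-lc@(_ , _ , conn) P along u∈K w∈K = go u∈K (Equivalence.to (conn u∈K _) w∈K)
    where
    go : ∀ {u w} → u ∈ K → Star Edge u w → P u → P w
    go u∈K ε Pu = Pu
    go u∈K ((_ , v∈ , u~v) ◅ rest) Pu = go v∈K rest (along u∈K v∈K u~v Pu)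
      where v∈K = closed K-lc u∈K (x∉⁅y⁆⇒x≢y (x∈∁p⇒x∉p v∈)) u~v

  restrict : ∀ {ρ S T} → (∀ {v} → T v → S v) → Represents G ρ S → Represents G ρ T
  restrict T⊆S rep = record
    { meet = λ Tv Tw → meet rep (T⊆S Tv) (T⊆S Tw)
    ; sep  = λ Tv Tw → sep rep (T⊆S Tv) (T⊆S Tw)
    }

  Represents-reflect : ∀ {ρ S} → Represents G ρ S → Represents G (reflect ρ) S
  Represents-reflect {ρ} rep = record
    { meet = λ Sv Sw v~w → ℕ.∸-monoʳ-≤ (bound ρ) (meet rep Sw Sv (~-sym v~w))
    ; sep  = λ Sv Sw v≢w v≁w →
        Sum.map (reflect-before ρ) (reflect-before ρ) (Sum.swap (sep rep Sv Sw v≢w v≁w))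
    }

  module _ {ρ : Placement order} {S : Pred (Vertex G) 0ℓ} (rep : Represents G ρ S) where

    Inside⇒~ : ∀ {v} → S v → S z → Inside ρ v z → v ~ z
    Inside⇒~ {v} Sv Sz ins@(lz≤lv , rv≤rz , _) =
      decidable-stable (v ~? z) λ v≁z → [ right , left ]′ (sep rep Sv Sz (λ { refl → Inside-irrefl ρ ins }) v≁z)
      where
      right : ¬ r ρ v < l ρ z
      right rv<lz = ℕ.<⇒≱ rv<lz (ℕ.≤-trans lz≤lv (l≤r ρ v))
      left : ¬ r ρ z < l ρ v
      left rz<lv = ℕ.<⇒≱ rz<lv (ℕ.≤-trans (l≤r ρ v) rv≤rz)

    before : ∀ {v w} → S v → S w → v ≢ w → ¬ v ~ w → l ρ v ≤ r ρ w → r ρ v < l ρ w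
    before Sv Sw v≢w v≁w lv≤rw with sep rep Sv Sw v≢w v≁w
    ... | inj₁ rv<lw = rv<lw
    ... | inj₂ rw<lv = contradiction lv≤rw (ℕ.<⇒≱ rw<lv)

    module _ (K-lc : LocalComponent K) (K⊆S : ∀ {v} → v ∈ K → S v) where

      module _ (x : ℕ) (avoid : ∀ {v} → v ∈ K → r ρ v < x ⊎ x < l ρ v) where

        -- Two adjacent intervals that both avoid `x` lie on the same side of it, since otherwise
        -- they would not meet.
        left-of : ∀ {u w} → u ∈ K → w ∈ K → r ρ u < x → r ρ w < x
        left-of = spread K-lc (λ v → r ρ v < x) λ {u} {v} u∈K v∈K u~v ru<x →
          [ id , (λ x<lv → contradiction (meet rep (K⊆S v∈K) (K⊆S u∈K) (~-sym u~v))
                             (ℕ.<⇒≱ (ℕ.<-trans ru<x x<lv))) ]′ (avoid v∈K)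

        right-of : ∀ {u w} → u ∈ K → w ∈ K → x < l ρ u → x < l ρ w
        right-of = spread K-lc (λ v → x < l ρ v) λ {u} {v} u∈K v∈K u~v x<lu →
          [ (λ rv<x → contradiction (meet rep (K⊆S u∈K) (K⊆S v∈K) u~v)
                        (ℕ.<⇒≱ (ℕ.<-trans rv<x x<lu))) , id ]′ (avoid v∈K)

      -- K is connected, so it cannot jump over a point x occupied by a vertex outside K.
      module _ {y : Vertex G} (Sy : S y) (y∉K : y ∉ K) (y≢z : y ≢ z)
               {x : ℕ} (ly≤x : l ρ y ≤ x) (x≤ry : x ≤ r ρ y) where

        avoids : ∀ {v} → v ∈ K → r ρ v < x ⊎ x < l ρ v
        avoids v∈K = Sum.map (λ rv<ly → ℕ.<-≤-trans rv<ly ly≤x) (λ ry<lv → ℕ.≤-<-trans x≤ry ry<lv)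
          (sep rep (K⊆S v∈K) Sy (λ { refl → y∉K v∈K }) (≁-across K-lc v∈K y∉K y≢z))

        one-side : (∀ {v} → v ∈ K → r ρ v < x) ⊎ (∀ {v} → v ∈ K → x < l ρ v)
        one-side with proj₁ K-lc
        ... | u , u∈K with avoids u∈K
        ... | inj₁ ru<x = inj₁ λ v∈K → left-of x avoids u∈K v∈K ru<x
        ... | inj₂ x<lu = inj₂ λ v∈K → right-of x avoids u∈K v∈K x<lu

        -- The whole of `K` lies on one side of `x`, a point of `z`. A member of `B` can therefore
        -- fail to be inside `z` only at the end on that side, which is the same end for all of `B`.
        protrusion : l ρ z ≤ x → x ≤ r ρ z → ∀ {B} → B ⊆ K → (∀ {v} → v ∈ B → ¬ Inside ρ v z) →
                     (∀ {v} → v ∈ B → l ρ v ≤ l ρ z) ⊎ (∀ {v} → v ∈ B → r ρ z ≤ r ρ v)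
        protrusion lz≤x x≤rz B⊆K noninside with one-side
        ... | inj₁ left = inj₁ λ v∈B → ℕ.≮⇒≥ λ lz<lv → noninside v∈B
                (ℕ.<⇒≤ lz<lv , ℕ.≤-trans (ℕ.<⇒≤ (left (B⊆K v∈B))) x≤rz , inj₁ lz<lv)
        ... | inj₂ right = inj₂ λ v∈B → ℕ.≮⇒≥ λ rv<rz → noninside v∈B
                (ℕ.≤-trans lz≤x (ℕ.<⇒≤ (right (B⊆K v∈B))) , ℕ.<⇒≤ rv<rz , inj₂ rv<rz)

  -- Side components are described by vertices rather than by a quantification over local
  -- components, which makes the property decidable.
  Left Right : Placement order → VertexSet G → Set
  Left  ρ K = ∀ u w → u ∈ K → w ∉ K → w ≢ z → r ρ u < l ρ w
  Right ρ K = ∀ u w → u ∈ K → w ∉ K → w ≢ z → r ρ w < l ρ u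

  Right? : ∀ ρ K → Dec (Right ρ K)
  Right? ρ K = all? λ u → all? λ w →
    u ∈? K →-dec ¬? (w ∈? K) →-dec ¬? (w ≟ z) →-dec r ρ w ℕ.<? l ρ u

  Left⇒Right-reflect : ∀ ρ {K} → Left ρ K → Right (reflect ρ) K
  Left⇒Right-reflect ρ left u w u∈K w∉K w≢z = reflect-before ρ (left u w u∈K w∉K w≢z)

  Right-reflect⇒Left : ∀ ρ {K} → Right (reflect ρ) K → Left ρ K
  Right-reflect⇒Left ρ right u w u∈K w∉K w≢z = reflect-before⁻ ρ (right u w u∈K w∉K w≢z)

  Right⇒Left-reflect : ∀ ρ {K} → Right ρ K → Left (reflect ρ) K
  Right⇒Left-reflect ρ right u w u∈K w∉K w≢z = reflect-before ρ (right u w u∈K w∉K w≢z)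

  Left-disjoint : ∀ ρ {K L} → LocalComponent K → LocalComponent L → (∀ {v} → v ∈ L → v ∉ K) →
                  Left ρ K → ¬ Left ρ L
  Left-disjoint ρ K-lc@((u , u∈K) , _) L-lc@((w , w∈L) , _) L#K K-left L-left = ℕ.<-asym
    (ℕ.≤-<-trans (l≤r ρ u) (K-left u w u∈K (L#K w∈L) (∈⇒≢z L-lc w∈L)))
    (ℕ.≤-<-trans (l≤r ρ w) (L-left w u w∈L (λ u∈L → L#K u∈L u∈K) (∈⇒≢z K-lc u∈K)))

  Right-disjoint : ∀ ρ {K L} → LocalComponent K → LocalComponent L → (∀ {v} → v ∈ L → v ∉ K) →
                   Right ρ K → ¬ Right ρ L
  Right-disjoint ρ K-lc L-lc L#K K-right L-right = Left-disjoint (reflect ρ) K-lc L-lc L#K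
    (Right⇒Left-reflect ρ K-right) (Right⇒Left-reflect ρ L-right)

  -- K is placed leftmost with the part to the left of the cut c protruding from z, D
  -- strictly inside z next to it, and everything else far to the right as in ρ.  The
  -- endpoints of K are doubled so that the left endpoint of z fits strictly between the
  -- left endpoints up to c and the right endpoints from c on.
  module Rearrangement
    {ρK ρD ρ : Placement order} {K D : VertexSet G} (c : ℕ)
    (K-lc : LocalComponent K) (D-lc : LocalComponent D) (disjoint : ∀ {v} → v ∈ K → v ∉ D)
    (repK : Represents G ρK (_∈ K)) (repD : Represents G ρD (_∈ D))
    (rep : Represents G ρ (λ v → v ∉ K × v ∉ D))
    (c≤r : ∀ {v} → v ∈ K → c ≤ r ρK v)
    (K~z : ∀ {v} → v ∈ K → v ~ z) (D~z : ∀ {v} → v ∈ D → v ~ z)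
    (rest-right : ∀ {v} → v ∉ K → v ∉ D → v ≢ z → l ρ z < l ρ v)
    where

    private
      -- `K` occupies numbers below `a`, `D` those from `a` to below `C`, and the rest begins at
      -- `C`. The summand 2 leaves room for the odd right ends `suc (m + m)`.
      a C : ℕ
      a = 2 + (bound ρK + bound ρK)
      C = suc (a + bound ρD)

      data Kind (v : Vertex G) : Set where
        inK  : v ∈ K → Kind v
        inD  : v ∉ K → v ∈ D → Kind v
        isZ  : v ≡ z → Kind v
        rest : v ∉ K → v ∉ D → v ≢ z → Kind v

      kind : ∀ v → Kind v
      kind v with v ∈? K | v ∈? D | v ≟ z
      ... | yes v∈K | _       | _       = inK v∈K
      ... | no  v∉K | yes v∈D | _       = inD v∉K v∈D
      ... | no  _   | no  _   | yes v≡z = isZ v≡z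
      ... | no  v∉K | no  v∉D | no  v≢z = rest v∉K v∉D v≢z

      -- Within `K`, left ends are even and right ends odd, and `z` starts at the odd number
      -- belonging to `c`. Hence a left end equal to `c` protrudes strictly, while a right end equal
      -- to `c` still meets `z`. Strictness matters because `z` now ends far to the right, so that a
      -- shared left end would put the interval inside.
      lo hi : ∀ {v} → Kind v → ℕ
      lo {v} (inK _)      = l ρK v + l ρK v
      lo {v} (inD _ _)    = a + l ρD v
      lo {v} (isZ _)      = suc (c + c)
      lo {v} (rest _ _ _) = C + l ρ v
      hi {v} (inK _)      = suc (r ρK v + r ρK v)
      hi {v} (inD _ _)    = a + r ρD v
      hi {v} (isZ _)      = C + r ρ z
      hi {v} (rest _ _ _) = C + r ρ v

      double-≤ : ∀ {m n} → m ≤ n → m + m ≤ n + n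
      double-≤ m≤n = ℕ.+-mono-≤ m≤n m≤n

      double-< : ∀ {m n} → m < n → suc (m + m) < n + n
      double-< {m} m<n = ℕ.≤-trans (ℕ.≤-reflexive (cong suc (sym (ℕ.+-suc m m)))) (double-≤ m<n)

      c≤boundK : c ≤ bound ρK
      c≤boundK = ℕ.≤-trans (c≤r (proj₂ (proj₁ K-lc))) (r≤bound ρK _)

      <a : ∀ {m} → m ≤ bound ρK → suc (m + m) < a
      <a m≤ = s≤s (s≤s (double-≤ m≤))

      a+<C : ∀ {m} → m ≤ bound ρD → a + m < C
      a+<C m≤ = s≤s (ℕ.+-monoʳ-≤ a m≤)

      a≤C : a ≤ C
      a≤C = ℕ.≤-trans (ℕ.m≤m+n a (bound ρD)) (ℕ.n≤1+n _)

      hiK<C : ∀ v → suc (r ρK v + r ρK v) < C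
      hiK<C v = ℕ.<-≤-trans (<a (r≤bound ρK v)) a≤C

      loK≤a : ∀ v → l ρK v + l ρK v ≤ a
      loK≤a v = ℕ.≤-trans (ℕ.n≤1+n _) (ℕ.<⇒≤ (<a (l≤bound ρK v)))

      loz≤C : suc (c + c) ≤ C
      loz≤C = ℕ.≤-trans (ℕ.<⇒≤ (<a c≤boundK)) a≤C

      lo≤hi : ∀ {v} (k : Kind v) → lo k ≤ hi k
      lo≤hi {v} (inK _)      = ℕ.m≤n⇒m≤1+n (double-≤ (l≤r ρK v))
      lo≤hi {v} (inD _ _)    = ℕ.+-monoʳ-≤ a (l≤r ρD v)
      lo≤hi {v} (isZ _)      = ℕ.m≤n⇒m≤n+o (r ρ z) loz≤C
      lo≤hi {v} (rest _ _ _) = ℕ.+-monoʳ-≤ C (l≤r ρ v)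

      hi≤bound : ∀ {v} (k : Kind v) → hi k ≤ C + bound ρ
      hi≤bound {v} (inK _)      = ℕ.m≤n⇒m≤n+o (bound ρ) (ℕ.<⇒≤ (hiK<C v))
      hi≤bound {v} (inD _ _)    = ℕ.m≤n⇒m≤n+o (bound ρ) (ℕ.<⇒≤ (a+<C (r≤bound ρD v)))
      hi≤bound {v} (isZ _)      = ℕ.+-monoʳ-≤ C (r≤bound ρ z)
      hi≤bound {v} (rest _ _ _) = ℕ.+-monoʳ-≤ C (r≤bound ρ v)

      meets : ∀ {v w} (k : Kind v) (k′ : Kind w) → v ~ w → lo k ≤ hi k′
      meets (inK v∈K) (inK w∈K) v~w = ℕ.m≤n⇒m≤1+n (double-≤ (meet repK v∈K w∈K v~w))
      meets (inK v∈K) (inD w∉K w∈D) v~w = contradiction v~w (≁-across K-lc v∈K w∉K (∈⇒≢z D-lc w∈D))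
      meets {v} (inK v∈K) (isZ _) v~w = ℕ.m≤n⇒m≤n+o (r ρ z) (ℕ.≤-trans (loK≤a v) a≤C)
      meets (inK v∈K) (rest w∉K _ w≢z) v~w = contradiction v~w (≁-across K-lc v∈K w∉K w≢z)
      meets (inD v∉K v∈D) (inK w∈K) v~w =
        contradiction (~-sym v~w) (≁-across K-lc w∈K v∉K (∈⇒≢z D-lc v∈D))
      meets (inD _ v∈D) (inD _ w∈D) v~w = ℕ.+-monoʳ-≤ a (meet repD v∈D w∈D v~w)
      meets {v} (inD _ _) (isZ _) v~w = ℕ.m≤n⇒m≤n+o (r ρ z) (ℕ.<⇒≤ (a+<C (l≤bound ρD v)))
      meets (inD _ v∈D) (rest _ w∉D w≢z) v~w = contradiction v~w (≁-across D-lc v∈D w∉D w≢z)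
      meets (isZ refl) (inK w∈K) v~w = s≤s (double-≤ (c≤r w∈K))
      meets {w = w} (isZ _) (inD _ _) v~w = ℕ.m≤n⇒m≤n+o (r ρD w) (ℕ.<⇒≤ (<a c≤boundK))
      meets (isZ refl) (isZ refl) v~w = contradiction v~w ~-irr
      meets {w = w} (isZ _) (rest _ _ _) v~w = ℕ.m≤n⇒m≤n+o (r ρ w) loz≤C
      meets (rest v∉K _ v≢z) (inK w∈K) v~w = contradiction (~-sym v~w) (≁-across K-lc w∈K v∉K v≢z)
      meets (rest _ v∉D v≢z) (inD _ w∈D) v~w = contradiction (~-sym v~w) (≁-across D-lc w∈D v∉D v≢z)
      meets (rest v∉K v∉D _) (isZ refl) v~w =
        ℕ.+-monoʳ-≤ C (meet rep (v∉K , v∉D) (z∉ K-lc , z∉ D-lc) v~w)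
      meets (rest v∉K v∉D _) (rest w∉K w∉D _) v~w =
        ℕ.+-monoʳ-≤ C (meet rep (v∉K , v∉D) (w∉K , w∉D) v~w)

      shift : ∀ {m n m′ n′} → m < n ⊎ m′ < n′ → C + m < C + n ⊎ C + m′ < C + n′
      shift = Sum.map (ℕ.+-monoʳ-< C) (ℕ.+-monoʳ-< C)

      beyond-z : ∀ {v} → v ∉ K → v ∉ D → v ≢ z → ¬ v ~ z → C + r ρ z < C + l ρ v
      beyond-z v∉K v∉D v≢z v≁z = ℕ.+-monoʳ-< C (before rep (z∉ K-lc , z∉ D-lc) (v∉K , v∉D)
        (v≢z ∘ sym) (v≁z ∘ ~-sym) (ℕ.≤-trans (ℕ.<⇒≤ (rest-right v∉K v∉D v≢z)) (l≤r ρ _)))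

      separate : ∀ {v w} (k : Kind v) (k′ : Kind w) → v ≢ w → ¬ v ~ w → hi k < lo k′ ⊎ hi k′ < lo k
      separate (inK v∈K) (inK w∈K) v≢w v≁w = Sum.map double-< double-< (sep repK v∈K w∈K v≢w v≁w)
      separate {v} {w} (inK _) (inD _ _) _ _ = inj₁ (ℕ.m≤n⇒m≤n+o (l ρD w) (<a (r≤bound ρK v)))
      separate (inK v∈K) (isZ refl) _ v≁w = contradiction (K~z v∈K) v≁w
      separate {v} {w} (inK _) (rest _ _ _) _ _ = inj₁ (ℕ.m≤n⇒m≤n+o (l ρ w) (hiK<C v))
      separate {v} {w} (inD _ _) (inK _) _ _ = inj₂ (ℕ.m≤n⇒m≤n+o (l ρD v) (<a (r≤bound ρK w)))
      separate (inD _ v∈D) (inD _ w∈D) v≢w v≁w =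
        Sum.map (ℕ.+-monoʳ-< a) (ℕ.+-monoʳ-< a) (sep repD v∈D w∈D v≢w v≁w)
      separate (inD _ v∈D) (isZ refl) _ v≁w = contradiction (D~z v∈D) v≁w
      separate {v} {w} (inD _ _) (rest _ _ _) _ _ = inj₁ (ℕ.m≤n⇒m≤n+o (l ρ w) (a+<C (r≤bound ρD v)))
      separate (isZ refl) (inK w∈K) _ v≁w = contradiction (~-sym (K~z w∈K)) v≁w
      separate (isZ refl) (inD _ w∈D) _ v≁w = contradiction (~-sym (D~z w∈D)) v≁w
      separate (isZ refl) (isZ refl) v≢w _ = contradiction refl v≢w
      separate (isZ refl) (rest w∉K w∉D w≢z) v≢w v≁w =
        inj₁ (beyond-z w∉K w∉D w≢z (v≁w ∘ ~-sym))
      separate {v} {w} (rest _ _ _) (inK _) _ _ = inj₂ (ℕ.m≤n⇒m≤n+o (l ρ v) (hiK<C w))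
      separate {v} {w} (rest _ _ _) (inD _ _) _ _ = inj₂ (ℕ.m≤n⇒m≤n+o (l ρ v) (a+<C (r≤bound ρD w)))
      separate (rest v∉K v∉D v≢z) (isZ refl) _ v≁w = inj₂ (beyond-z v∉K v∉D v≢z v≁w)
      separate (rest v∉K v∉D _) (rest w∉K w∉D _) v≢w v≁w =
        shift (sep rep (v∉K , v∉D) (w∉K , w∉D) v≢w v≁w)

    placement : Placement order
    placement = record
      { l       = lo ∘ kind
      ; r       = hi ∘ kind
      ; l≤r     = lo≤hi ∘ kind
      ; bound   = C + bound ρ
      ; r≤bound = hi≤bound ∘ kind
      }

    represents : Represents G placement U
    represents = record
      { meet = λ {v} {w} _ _ → meets (kind v) (kind w)
      ; sep  = λ {v} {w} _ _ → separate (kind v) (kind w)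
      }

    leftmost : Left placement K
    leftmost u w u∈K w∉K w≢z = go (kind u) (kind w)
      where
      go : (k : Kind u) (k′ : Kind w) → hi k < lo k′
      go _              (inK w∈K)    = contradiction w∈K w∉K
      go (inK _)        (inD _ _)    = ℕ.m≤n⇒m≤n+o (l ρD w) (<a (r≤bound ρK u))
      go _              (isZ w≡z)    = contradiction w≡z w≢z
      go (inK _)        (rest _ _ _) = ℕ.m≤n⇒m≤n+o (l ρ w) (hiK<C u)
      go (inD u∉K _)    _            = contradiction u∈K u∉K
      go (isZ refl)     _            = contradiction u∈K (z∉ K-lc)
      go (rest u∉K _ _) _            = contradiction u∈K u∉K

    -- The cut decides about `K`, and all of `D` may be inside. The rest and the right end of `z`
    -- are shifted by the same `C`, and their left ends already exceeded that of `z`, so their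
    -- containment can be read off from `ρ`.
    inside-cases : ∀ {v} → Inside placement v z →
                   (v ∈ K × c < l ρK v) ⊎ v ∈ D ⊎ (v ∉ K × v ∉ D × v ≢ z × Inside ρ v z)
    inside-cases {v} = go (kind v) (kind z)
      where
      go : (k : Kind v) (k′ : Kind z) →
           lo k′ ≤ lo k × hi k ≤ hi k′ × (lo k′ < lo k ⊎ hi k < hi k′) →
           (v ∈ K × c < l ρK v) ⊎ v ∈ D ⊎ (v ∉ K × v ∉ D × v ≢ z × Inside ρ v z)
      go _ (inK z∈K)    _ = contradiction z∈K (z∉ K-lc)
      go _ (inD _ z∈D)  _ = contradiction z∈D (z∉ D-lc)
      go _ (rest _ _ z≢z) _ = contradiction refl z≢z
      go (inK v∈K) (isZ _) (loz≤ , _) =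
        inj₁ (v∈K , ℕ.≰⇒> λ lv≤c → ℕ.<⇒≱ loz≤ (double-≤ lv≤c))
      go (inD _ v∈D) (isZ _) _ = inj₂ (inj₁ v∈D)
      go (isZ refl) (isZ _) (_ , _ , strict) =
        contradiction strict [ ℕ.<-irrefl refl , ℕ.<-irrefl refl ]′
      go (rest v∉K v∉D v≢z) (isZ _) (_ , hi≤hi , _) =
        inj₂ (inj₂ (v∉K , v∉D , v≢z , ℕ.<⇒≤ lz<lv , ℕ.+-cancelˡ-≤ C _ _ hi≤hi , inj₁ lz<lv))
        where lz<lv = rest-right v∉K v∉D v≢z

  -- Consequences of minimality and of the basepoint property.

  module Minimal (p q : ℕ) (p<q : p < q)
    (basepoint : ∀ ρ → Represents G ρ U → q ≤ ∣ insiders ρ z ∣)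
    (deletion : ∀ h → h ≢ z → Σ[ γ ∈ Placement order ] Represents G γ (_≢ h) ×
                  (∀ P → h ∉ P → (∀ {v} → v ∈ P → Inside γ v z) → ∣ P ∣ ≤ p))
    where

    -- The source of all lower bounds below: a set that covers the insiders of some representation
    -- has at least `q` members.
    many-insiders : ∀ {ρ} → Represents G ρ U → ∀ P → (∀ {v} → Inside ρ v z → v ∈ P) → q ≤ ∣ P ∣
    many-insiders {ρ} rep P ins⊆P = ℕ.≤-trans (basepoint ρ rep)
      (p⊆q⇒∣p∣≤∣q∣ (ins⊆P ∘ ∈-fromDec⁻ (λ v → inside? ρ v z)))

    all-outside⇒clique : ∀ {β H} → Represents G β U → LocalComponent H → (∀ {v} → v ∈ H → v ~ z) →
                         (∀ {v} → v ∈ H → ¬ Inside β v z) → IsClique G H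
    all-outside⇒clique {β} {H} rep H-lc H~z noninside {u} {w} u∈H w∈H u≢w with nonempty? (insiders β z)
    ... | no empty = contradiction
            (ℕ.≤-trans (many-insiders rep ⊥ λ ins → ⊥-elim (empty (_ , ∈-fromDec⁺ (λ v → inside? β v z) ins)))
                       (ℕ.≤-reflexive (∣⊥∣≡0 order)))
            (ℕ.<⇒≱ (ℕ.≤-<-trans z≤n p<q))
    ... | yes (y , y∈) = decidable-stable (u ~? w) λ u≁w →
            [ apart u∈H w∈H , apart w∈H u∈H ]′ (sep rep _ _ u≢w u≁w)
      where
      y-inside : Inside β y z
      y-inside = ∈-fromDec⁻ (λ v → inside? β v z) y∈

      apart : ∀ {u w} → u ∈ H → w ∈ H → ¬ r β u < l β w
      -- The point that `H` cannot cross is the left end of `y`, which belongs to `z` because `y` is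
      -- inside.
      apart u∈H w∈H u<w with protrusion rep H-lc _ _ (λ y∈H → noninside y∈H y-inside)
        (λ { refl → Inside-irrefl β y-inside }) ℕ.≤-refl (l≤r β y)
        (proj₁ y-inside) (ℕ.≤-trans (l≤r β y) (proj₁ (proj₂ y-inside))) id noninside
      -- Every member of `H` starts no later than `z` and meets it, so all contain the left end of
      -- `z`; the other case is the same at the right end.
      ... | inj₁ left  = ℕ.<⇒≱ u<w (ℕ.≤-trans (left w∈H) (meet rep _ _ (~-sym (H~z u∈H))))
      ... | inj₂ right = ℕ.<⇒≱ u<w (ℕ.≤-trans (meet rep _ _ (H~z w∈H)) (right u∈H))

    -- A local component without neighbour of z could be moved away after deleting one of its
    -- vertices, so that z would contain at most p intervals.
    touches : ∀ {ρ} → Represents G ρ U → LocalComponent K → ∃[ u ] u ∈ K × u ~ z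
    touches {K} {ρ} rep K-lc@((k , k∈K) , _) with any? (λ u → u ∈? K ×-dec u ~? z)
    ... | yes touching = touching
    ... | no  isolated = contradiction (ℕ.≤-trans (many-insiders ν-rep P inside⇒P) ∣P∣≤p) (ℕ.<⇒≱ p<q)
      where
      γ     = proj₁ (deletion k (∈⇒≢z K-lc k∈K))
      γ-rep = proj₁ (proj₂ (deletion k (∈⇒≢z K-lc k∈K)))
      γ-few = proj₂ (proj₂ (deletion k (∈⇒≢z K-lc k∈K)))

      C : ℕ
      C = suc (bound γ)

      lo hi : ∀ {v} → Dec (v ∈ K) → ℕ
      lo {v} (yes _) = C + l ρ v
      lo {v} (no  _) = l γ v
      hi {v} (yes _) = C + r ρ v
      hi {v} (no  _) = r γ v

      lo≤hi : ∀ {v} (d : Dec (v ∈ K)) → lo d ≤ hi d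
      lo≤hi {v} (yes _) = ℕ.+-monoʳ-≤ C (l≤r ρ v)
      lo≤hi {v} (no  _) = l≤r γ v

      hi≤bound : ∀ {v} (d : Dec (v ∈ K)) → hi d ≤ C + bound ρ
      hi≤bound {v} (yes _) = ℕ.+-monoʳ-≤ C (r≤bound ρ v)
      hi≤bound {v} (no  _) = ℕ.m≤n⇒m≤n+o (bound ρ) (ℕ.m≤n⇒m≤1+n (r≤bound γ v))

      ν : Placement order
      -- `K`, including the deleted `k`, copies `ρ` beyond everything in `γ`; all other vertices
      -- copy `γ`.
      ν = record
        { l       = λ v → lo (v ∈? K)
        ; r       = λ v → hi (v ∈? K)
        ; l≤r     = λ v → lo≤hi (v ∈? K)
        ; bound   = C + bound ρ
        ; r≤bound = λ v → hi≤bound (v ∈? K)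
        }

      across : ∀ {v w} → v ∈ K → w ∉ K → ¬ v ~ w
      across {v} {w} v∈K w∉K v~w with w ≟ z
      ... | yes refl = isolated (v , v∈K , v~w)
      ... | no  w≢z  = ≁-across K-lc v∈K w∉K w≢z v~w

      ∉⇒≢k : ∀ {v} → v ∉ K → v ≢ k
      ∉⇒≢k v∉K refl = v∉K k∈K

      meets : ∀ {v w} (d : Dec (v ∈ K)) (e : Dec (w ∈ K)) → v ~ w → lo d ≤ hi e
      meets (yes _)   (yes _)   v~w = ℕ.+-monoʳ-≤ C (meet rep _ _ v~w)
      meets (yes v∈K) (no w∉K)  v~w = contradiction v~w (across v∈K w∉K)
      meets (no v∉K)  (yes w∈K) v~w = contradiction (~-sym v~w) (across w∈K v∉K)
      meets (no v∉K)  (no w∉K)  v~w = meet γ-rep (∉⇒≢k v∉K) (∉⇒≢k w∉K) v~w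

      separate : ∀ {v w} (d : Dec (v ∈ K)) (e : Dec (w ∈ K)) → v ≢ w → ¬ v ~ w → hi d < lo e ⊎ hi e < lo d
      separate (yes _) (yes _) v≢w v≁w =
        Sum.map (ℕ.+-monoʳ-< C) (ℕ.+-monoʳ-< C) (sep rep _ _ v≢w v≁w)
      separate {v} {w} (yes _) (no _) _ _ = inj₂ (ℕ.m≤n⇒m≤n+o (l ρ v) (s≤s (r≤bound γ w)))
      separate {v} {w} (no _) (yes _) _ _ = inj₁ (ℕ.m≤n⇒m≤n+o (l ρ w) (s≤s (r≤bound γ v)))
      separate (no v∉K) (no w∉K) v≢w v≁w = sep γ-rep (∉⇒≢k v∉K) (∉⇒≢k w∉K) v≢w v≁w

      ν-rep : Represents G ν U
      ν-rep = record
        { meet = λ {v} {w} _ _ → meets (v ∈? K) (w ∈? K)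
        ; sep  = λ {v} {w} _ _ → separate (v ∈? K) (w ∈? K)
        }

      P : VertexSet G
      P = insiders γ z ∩ ∁ K

      ∣P∣≤p : ∣ P ∣ ≤ p
      ∣P∣≤p = γ-few P (λ k∈P → x∈∁p⇒x∉p (proj₂ (x∈p∩q⁻ _ _ k∈P)) k∈K)
        (λ v∈P → ∈-fromDec⁻ (λ v → inside? γ v z) (proj₁ (x∈p∩q⁻ _ _ v∈P)))

      inside⇒P : ∀ {v} → Inside ν v z → v ∈ P
      inside⇒P {v} = go (v ∈? K) (z ∈? K)
        where
        go : (d : Dec (v ∈ K)) (e : Dec (z ∈ K)) →
             lo e ≤ lo d × hi d ≤ hi e × (lo e < lo d ⊎ hi d < hi e) → v ∈ P
        go _         (yes z∈K) _ = contradiction z∈K (z∉ K-lc)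
        go (yes _)   (no _) (_ , hi≤ , _) =
          contradiction hi≤ (ℕ.<⇒≱ (ℕ.m≤n⇒m≤n+o (r ρ v) (s≤s (r≤bound γ z))))
        go (no v∉K)  (no _) ins = x∈p∩q⁺ (∈-fromDec⁺ (λ v → inside? γ v z) ins , x∉p⇒x∈∁p v∉K)

    -- Exchanging the left side component with another local component.

    module SideComponent {ρ : Placement order} (ρ-rep : Represents G ρ U) (∣insiders∣≤q : ∣ insiders ρ z ∣ ≤ q)
      {H : VertexSet G} (H-lc : LocalComponent H) (H~z : ∀ {v} → v ∈ H → v ~ z)
      (H-clique : IsClique G H) (H-left : Left ρ H)
      where

      -- Some `h` in `H` meets `z`, so `z` starts no later than `h` ends, and everything else starts
      -- after that.
      z<rest : ∀ {v} → v ∉ H → v ≢ z → l ρ z < l ρ v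
      z<rest v∉H v≢z with proj₁ H-lc
      ... | h , h∈H = ℕ.≤-<-trans (meet ρ-rep _ _ (~-sym (H~z h∈H))) (H-left _ _ h∈H v∉H v≢z)

      -- A vertex `v` of `K` reaching beyond the right end of `z` would make `K` rightmost: any
      -- other component has, by `touches`, a neighbour `y` of `z`, which must end before `v`
      -- starts. Connectedness of both components spreads this from `y` and `v` to all pairs.
      interior : LocalComponent K → (∀ {v} → v ∈ K → v ∉ H) → ¬ Right ρ K → ∀ {v} → v ∈ K → Inside ρ v z
      interior {K} K-lc K#H ¬right {v} v∈K with r ρ v ℕ.≤? r ρ z
      ... | yes rv≤rz = ℕ.<⇒≤ z<v , rv≤rz , inj₁ z<v
        where z<v = z<rest (K#H v∈K) (∈⇒≢z K-lc v∈K)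
      ... | no  rv≰rz = contradiction right ¬right
        where
        right : Right ρ K
        right u w u∈K w∉K w≢z with component w w≢z
        ... | W , W-lc , w∈W with touches ρ-rep W-lc
        ... | y , y∈W , y~z = left-of ρ-rep W-lc _ (l ρ u) W-avoids y∈W w∈W y<u
          where
          W#K : ∀ {x} → x ∈ W → x ∉ K
          W#K x∈W x∈K = w∉K (meeting⇒⊆ W-lc K-lc x∈W x∈K w∈W)

          y<v : r ρ y < l ρ v
          y<v = before ρ-rep _ _ (λ { refl → W#K y∈W v∈K })
            (≁-across W-lc y∈W (λ v∈W → W#K v∈W v∈K) (∈⇒≢z K-lc v∈K))
            (ℕ.≤-trans (meet ρ-rep _ _ y~z) (ℕ.<⇒≤ (ℕ.≰⇒> rv≰rz)))

          y<u : r ρ y < l ρ u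
          y<u = right-of ρ-rep K-lc _ (r ρ y)
            (avoids ρ-rep K-lc _ _ (W#K y∈W) (∈⇒≢z W-lc y∈W) (l≤r ρ y) ℕ.≤-refl) v∈K u∈K y<v

          W-avoids : ∀ {x} → x ∈ W → r ρ x < l ρ u ⊎ l ρ u < l ρ x
          W-avoids = avoids ρ-rep W-lc _ _ (λ u∈W → W#K u∈W u∈K) (∈⇒≢z K-lc u∈K) ℕ.≤-refl (l≤r ρ u)

      module _ (K-lc : LocalComponent K) (K#H : ∀ {v} → v ∈ K → v ∉ H) (¬right : ¬ Right ρ K)
               {B : VertexSet G} (B⊆K : B ⊆ K) where

        private
          K~z : ∀ {v} → v ∈ K → v ~ z
          K~z v∈K = Inside⇒~ ρ-rep _ _ (interior K-lc K#H ¬right v∈K)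

          -- Exchanging H and K in ρ, with B protruding, z gains at most |H| and loses |B| insiders.
          bound-left : ∀ {β} → Represents G β U → (∀ {v} → v ∈ B → l β v ≤ l β z) → ∣ B ∣ ≤ ∣ H ∣
          bound-left {β} β-rep B-left = ℕ.+-cancelʳ-≤ (∣ K ∩ ∁ B ∣ + ∣ X ∣) _ _ (begin
            ∣ B ∣ + (∣ K ∩ ∁ B ∣ + ∣ X ∣)          ≡⟨ ℕ.+-assoc ∣ B ∣ _ _ ⟨
            ∣ B ∣ + ∣ K ∩ ∁ B ∣ + ∣ X ∣            ≤⟨ ℕ.+-monoˡ-≤ ∣ X ∣ (disjoint⇒∣p∣+∣q∣≤∣r∣ B (K ∩ ∁ B) K B⊆K (p∩q⊆p K (∁ B))
                                                      λ v∈B v∈ → x∈∁p⇒x∉p (p∩q⊆q K (∁ B) v∈) v∈B) ⟩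
            ∣ K ∣ + ∣ X ∣                          ≤⟨ disjoint⇒∣p∣+∣q∣≤∣r∣ K X I
                                                      (∈-fromDec⁺ (λ v → inside? ρ v z) ∘ interior K-lc K#H ¬right)
                                                      (p∩q⊆p I (∁ (H ∪ K)))
                                                      (λ v∈K v∈X → x∈∁p⇒x∉p (p∩q⊆q I (∁ (H ∪ K)) v∈X) (q⊆p∪q H K v∈K)) ⟩
            ∣ I ∣                                  ≤⟨ ∣insiders∣≤q ⟩
            -- The exchange makes `H` insiders and frees `B`; the other insiders `X` occur on both
            -- sides and cancel.
            q                                      ≤⟨ many-insiders represents (K ∩ ∁ B ∪ H ∪ X) covered ⟩
            ∣ K ∩ ∁ B ∪ H ∪ X ∣                    ≤⟨ ∣p∪q∣≤∣p∣+∣q∣ (K ∩ ∁ B) (H ∪ X) ⟩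
            ∣ K ∩ ∁ B ∣ + ∣ H ∪ X ∣                ≤⟨ ℕ.+-monoʳ-≤ ∣ K ∩ ∁ B ∣ (∣p∪q∣≤∣p∣+∣q∣ H X) ⟩
            ∣ K ∩ ∁ B ∣ + (∣ H ∣ + ∣ X ∣)          ≡⟨ ℕ.+-assoc ∣ K ∩ ∁ B ∣ _ _ ⟨
            ∣ K ∩ ∁ B ∣ + ∣ H ∣ + ∣ X ∣            ≡⟨ cong (_+ ∣ X ∣) (ℕ.+-comm ∣ K ∩ ∁ B ∣ ∣ H ∣) ⟩
            ∣ H ∣ + ∣ K ∩ ∁ B ∣ + ∣ X ∣            ≡⟨ ℕ.+-assoc ∣ H ∣ _ _ ⟩
            ∣ H ∣ + (∣ K ∩ ∁ B ∣ + ∣ X ∣)          ∎)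
            where
            open ℕ.≤-Reasoning

            I X : VertexSet G
            I = insiders ρ z
            X = I ∩ ∁ (H ∪ K)

            -- `K` is arranged as in `β` and cut at the left end that `z` has there, which leaves
            -- `B` protruding.
            open Rearrangement {ρK = β} {ρD = ρ} {ρ = ρ} (l β z) K-lc H-lc K#H
              (restrict _ β-rep) (restrict _ ρ-rep) (restrict _ ρ-rep)
              (λ v∈K → meet β-rep _ _ (~-sym (K~z v∈K))) K~z H~z (λ _ v∉H v≢z → z<rest v∉H v≢z)

            covered : ∀ {v} → Inside placement v z → v ∈ K ∩ ∁ B ∪ H ∪ X
            covered ins with inside-cases ins
            ... | inj₁ (v∈K , z<v) = x∈p∪q⁺ (inj₁ (x∈p∩q⁺ (v∈K , x∉p⇒x∈∁p λ v∈B → ℕ.<⇒≱ z<v (B-left v∈B))))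
            ... | inj₂ (inj₁ v∈H) = x∈p∪q⁺ (inj₂ (x∈p∪q⁺ (inj₁ v∈H)))
            ... | inj₂ (inj₂ (v∉K , v∉H , _ , ins′)) = x∈p∪q⁺ (inj₂ (x∈p∪q⁺ (inj₂ (x∈p∩q⁺
                    (∈-fromDec⁺ (λ v → inside? ρ v z) ins′ ,
                     x∉p⇒x∈∁p ([ v∉H , v∉K ]′ ∘ x∈p∪q⁻ H K))))))

        -- Some `h` in `H` meets `z`, and the larger of their left ends is a point of `z` that `K`
        -- cannot cross. So all of `B` reaches the same end of `z`, and the right end is the mirror
        -- image of the left one.
        noncontributing≤ : ∀ {β} → Represents G β U → (∀ {v} → v ∈ B → ¬ Inside β v z) → ∣ B ∣ ≤ ∣ H ∣
        noncontributing≤ {β} β-rep noninside with proj₁ H-lc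
        ... | h , h∈H with protrusion β-rep K-lc _ _ (λ h∈K → K#H h∈K h∈H) (∈⇒≢z H-lc h∈H)
                             (ℕ.m≤m⊔n (l β h) (l β z))
                             (ℕ.⊔-lub (l≤r β h) (meet β-rep _ _ (~-sym (H~z h∈H))))
                             (ℕ.m≤n⊔m (l β h) (l β z))
                             (ℕ.⊔-lub (meet β-rep _ _ (H~z h∈H)) (l≤r β z)) B⊆K noninside
        ... | inj₁ left  = bound-left β-rep left
        ... | inj₂ right = bound-left (Represents-reflect β-rep) (λ v∈B → ℕ.∸-monoʳ-≤ (bound β) (right v∈B))

      -- A single common point suffices to represent `H` because `H` is a clique.
      point : Placement order
      point = record
        { l = const 0 ; r = const 0 ; l≤r = λ _ → z≤n ; bound = 0 ; r≤bound = λ _ → z≤n }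

      point-rep : Represents G point (_∈ H)
      point-rep = record
        { meet = λ _ _ _ → z≤n
        ; sep  = λ v∈H w∈H v≢w v≁w → contradiction (H-clique v∈H w∈H v≢w) v≁w
        }

      -- `H` is left out since the placement lacks a meaningful interval for `h`, and the rest of
      -- `H` is going to be placed anew.
      LeftmostBesidesH : Placement order → VertexSet G → Set
      LeftmostBesidesH γ L = ∀ u w → u ∈ L → w ∉ L → w ∉ H → w ≢ z → r γ u < l γ w

      -- What attaining the maximum requires, in terms of placements: `L` becomes a side component
      -- in `ν`, and `B` is the blocking set inside it. As `H` is leftmost in `ρ`, the conditions on
      -- `H` and `Right ρ L` keep `L` from being a side component there.
      Exchangeable : Set
      Exchangeable =
        Σ[ ν ∈ Placement order ] Represents G ν U ×
        ∃[ L ] LocalComponent L × (∀ {v} → v ∈ L → v ∉ H) × ¬ Right ρ L × Left ν L ×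
               (∀ {v} → v ∈ L → v ~ z) ×
        ∃[ B ] B ⊆ L × ∣ B ∣ ≡ ∣ H ∣ × (∀ {v} → v ∈ B → ¬ Inside ν v z)

      module Deleted {h : Vertex G} (h∈H : h ∈ H) {γ : Placement order} (γ-rep : Represents G γ (_≢ h))
        (γ-few : ∀ P → h ∉ P → (∀ {v} → v ∈ P → Inside γ v z) → ∣ P ∣ ≤ p)
        where

        private
          ∉H⇒≢h : ∀ {v} → v ∉ H → v ≢ h
          ∉H⇒≢h v∉H refl = v∉H h∈H

          z≢h : z ≢ h
          z≢h refl = z∉ H-lc h∈H

          I : VertexSet G
          I = insiders γ z

          ∈I⁺ : ∀ {v} → Inside γ v z → v ∈ I
          ∈I⁺ = ∈-fromDec⁺ (λ v → inside? γ v z)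

          ∈I⁻ : ∀ {v} → v ∈ I → Inside γ v z
          ∈I⁻ = ∈-fromDec⁻ (λ v → inside? γ v z)

        -- `L` is the component of a vertex with the least left end. It cannot cross the left end of
        -- any other `w`, and it has a vertex that does not start later.
        leftmostBesidesH : ∃[ v ] v ∉ H × v ≢ z →
          ∃[ L ] LocalComponent L × (∀ {v} → v ∈ L → v ∉ H) × LeftmostBesidesH γ L
        leftmostBesidesH others
          with minimiser (λ v → ¬? (v ∈? H) ×-dec ¬? (v ≟ z)) (l γ) others
        ... | v , (v∉H , v≢z) , minimal with component v v≢z
        ... | L , L-lc , v∈L = L , L-lc , L#H , λ u w u∈L w∉L w∉H w≢z →
          let L-avoids = avoids γ-rep L-lc (∉H⇒≢h ∘ L#H) (∉H⇒≢h w∉H) w∉L w≢z ℕ.≤-refl (l≤r γ w)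
          in left-of γ-rep L-lc (∉H⇒≢h ∘ L#H) (l γ w) L-avoids v∈L u∈L
               ([ id , (λ w<v → contradiction (minimal w (w∉H , w≢z)) (ℕ.<⇒≱ w<v)) ]′ (L-avoids v∈L))
          where
          L#H : ∀ {x} → x ∈ L → x ∉ H
          L#H x∈L x∈H = v∉H (meeting⇒⊆ L-lc H-lc x∈L x∈H v∈L)

        module _ {L : VertexSet G} (L-lc : LocalComponent L) (L#H : ∀ {v} → v ∈ L → v ∉ H)
                 (L-leftmost : LeftmostBesidesH γ L) where

          private
            L≢h : ∀ {v} → v ∈ L → v ≢ h
            L≢h = ∉H⇒≢h ∘ L#H

            X : VertexSet G
            X = I ∩ ∁ (H ∪ L)

            z<others : ∀ {v} → v ∉ L → v ∉ H → v ≢ z → l γ z < l γ v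
            z<others v∉L v∉H v≢z with touches ρ-rep L-lc
            ... | u , u∈L , u~z = ℕ.≤-<-trans (meet γ-rep z≢h (L≢h u∈L) (~-sym u~z))
                                              (L-leftmost _ _ u∈L v∉L v∉H v≢z)

          -- H takes over the leftmost place of L, and L goes inside z.
          replaced-by-H : (∀ {v} → v ∈ L → v ~ z) → q ≤ ∣ L ∪ X ∣
          replaced-by-H L~z = many-insiders represents (L ∪ X) covered
            where
            -- With all of `H` at the point 0 and the cut at 0, no vertex of `H` is inside `z`. The
            -- deleted `h` is placed along with `H`, so this represents all of `G`.
            open Rearrangement {ρK = point} {ρD = γ} {ρ = γ} 0 H-lc L-lc (λ v∈H v∈L → L#H v∈L v∈H)
              point-rep (restrict L≢h γ-rep) (restrict (∉H⇒≢h ∘ proj₁) γ-rep) (λ _ → z≤n)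
              H~z L~z (λ v∉H v∉L v≢z → z<others v∉L v∉H v≢z)

            covered : ∀ {v} → Inside placement v z → v ∈ L ∪ X
            covered ins with inside-cases ins
            ... | inj₁ (_ , ())
            ... | inj₂ (inj₁ v∈L) = x∈p∪q⁺ (inj₁ v∈L)
            ... | inj₂ (inj₂ (v∉H , v∉L , _ , ins′)) = x∈p∪q⁺ (inj₂ (x∈p∩q⁺
                    (∈I⁺ ins′ , x∉p⇒x∈∁p ([ v∉H , v∉L ]′ ∘ x∈p∪q⁻ H L))))

          module _ {R : VertexSet G} (R-lc : LocalComponent R) (R#H : ∀ {v} → v ∈ R → v ∉ H)
                   (R#L : ∀ {v} → v ∈ R → v ∉ L) where

            private
              -- The second component `R` touches `z` and lies to the right of `L`.
              L<rz : ∀ {v} → v ∈ L → r γ v < r γ z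
              L<rz v∈L with touches ρ-rep R-lc
              ... | w , w∈R , w~z = ℕ.<-≤-trans (L-leftmost _ _ v∈L (R#L w∈R) (R#H w∈R) (∈⇒≢z R-lc w∈R))
                                                (meet γ-rep (∉H⇒≢h (R#H w∈R)) z≢h w~z)

            -- Otherwise `h′` occupies the left end of `z`, which pushes `L`, since it touches `z`,
            -- completely inside. Then `replaced-by-H` represents `G` with insiders that were all
            -- inside `z` in `γ` already, hence at most `p` of them.
            not-left-of-z : ∀ {h′} → h′ ∈ H → h′ ≢ h → ¬ l γ h′ ≤ l γ z
            not-left-of-z {h′} h′∈H h′≢h h′≤z with touches ρ-rep L-lc
            ... | u , u∈L , u~z = ℕ.<⇒≱ p<q (ℕ.≤-trans
                    (replaced-by-H (λ v∈L → Inside⇒~ γ-rep (L≢h v∈L) z≢h (L-inside v∈L)))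
                    (γ-few (L ∪ X) h∉L∪X [L∪X]-inside))
              where
              L-avoids : ∀ {v} → v ∈ L → r γ v < l γ z ⊎ l γ z < l γ v
              L-avoids = avoids γ-rep L-lc L≢h h′≢h (λ h′∈L → L#H h′∈L h′∈H) (∈⇒≢z H-lc h′∈H) h′≤z
                (meet γ-rep z≢h h′≢h (~-sym (H~z h′∈H)))

              z<L : ∀ {v} → v ∈ L → l γ z < l γ v
              z<L v∈L = right-of γ-rep L-lc L≢h (l γ z) L-avoids u∈L v∈L
                ([ (λ u<z → contradiction (meet γ-rep z≢h (L≢h u∈L) (~-sym u~z)) (ℕ.<⇒≱ u<z)) , id ]′ (L-avoids u∈L))

              L-inside : ∀ {v} → v ∈ L → Inside γ v z
              L-inside v∈L = ℕ.<⇒≤ (z<L v∈L) , ℕ.<⇒≤ (L<rz v∈L) , inj₁ (z<L v∈L)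

              h∉L∪X : h ∉ L ∪ X
              h∉L∪X h∈ with x∈p∪q⁻ L X h∈
              ... | inj₁ h∈L = L#H h∈L h∈H
              ... | inj₂ h∈X = x∈∁p⇒x∉p (p∩q⊆q I (∁ (H ∪ L)) h∈X) (p⊆p∪q L h∈H)

              [L∪X]-inside : ∀ {v} → v ∈ L ∪ X → Inside γ v z
              [L∪X]-inside v∈ with x∈p∪q⁻ L X v∈
              ... | inj₁ v∈L = L-inside v∈L
              ... | inj₂ v∈X = ∈I⁻ (p∩q⊆p I (∁ (H ∪ L)) v∈X)

            -- In `γ` the vertex `z` contains `H∖h`, `L ∩ I` and `X`, at most `p` in all, whereas
            -- `replaced-by-H` shows that `L` and `X` together have at least `q` members. Cancelling
            -- `L ∩ I` and `X` leaves a strict inequality, which makes up for the missing `h`.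
            ∣H∣≤∣L∩∁I∣ : (∀ {v} → v ∈ H → v ≢ h → Inside γ v z) → (∀ {v} → v ∈ L → v ~ z) → ∣ H ∣ ≤ ∣ L ∩ ∁ I ∣
            ∣H∣≤∣L∩∁I∣ H-inside L~z = ℕ.≤-trans ∣H∣≤1+∣H∖h∣ ∣H∖h∣<∣L∩∁I∣
              where
              open ℕ.≤-Reasoning

              P : VertexSet G
              P = I ∩ ∁ ⁅ h ⁆

              ∣P∣≤p : ∣ P ∣ ≤ p
              ∣P∣≤p = γ-few P (λ h∈P → x∈∁p⇒x∉p (p∩q⊆q I (∁ ⁅ h ⁆) h∈P) (x∈⁅x⁆ h)) (∈I⁻ ∘ p∩q⊆p I (∁ ⁅ h ⁆))

              ∈P : ∀ {v} → v ∈ I → v ≢ h → v ∈ P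
              ∈P v∈I v≢h = x∈p∩q⁺ (v∈I , x∉p⇒x∈∁p (x≢y⇒x∉⁅y⁆ v≢h))

              X∉ : ∀ {v} → v ∈ X → v ∉ H × v ∉ L
              X∉ v∈X = v∉H∪L ∘ p⊆p∪q L , v∉H∪L ∘ q⊆p∪q H L
                where v∉H∪L = x∈∁p⇒x∉p (p∩q⊆q I (∁ (H ∪ L)) v∈X)

              H∖h : VertexSet G
              H∖h = H ∩ ∁ ⁅ h ⁆

              ∣H∣≤1+∣H∖h∣ : ∣ H ∣ ≤ suc ∣ H∖h ∣
              ∣H∣≤1+∣H∖h∣ = begin
                ∣ H ∣                        ≡⟨ ∣p∣≡∣p∩q∣+∣p∩∁q∣ H ⁅ h ⁆ ⟩
                ∣ H ∩ ⁅ h ⁆ ∣ + ∣ H∖h ∣      ≤⟨ ℕ.+-monoˡ-≤ ∣ H∖h ∣ (∣p∩q∣≤∣q∣ H ⁅ h ⁆) ⟩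
                ∣ ⁅ h ⁆ ∣ + ∣ H∖h ∣          ≡⟨ cong (_+ ∣ H∖h ∣) (∣⁅x⁆∣≡1 h) ⟩
                suc ∣ H∖h ∣                  ∎

              H∖h⊆P : H∖h ⊆ P
              H∖h⊆P v∈ with x∈p∩q⁻ H (∁ ⁅ h ⁆) v∈
              ... | v∈H , v≢h = x∈p∩q⁺ (∈I⁺ (H-inside v∈H (x∉⁅y⁆⇒x≢y (x∈∁p⇒x∉p v≢h))) , v≢h)

              few : ∣ H∖h ∣ + (∣ L ∩ I ∣ + ∣ X ∣) ≤ p
              few = begin
                ∣ H∖h ∣ + (∣ L ∩ I ∣ + ∣ X ∣)  ≤⟨ ℕ.+-monoʳ-≤ ∣ H∖h ∣ (disjoint⇒∣p∣+∣q∣≤∣r∣ (L ∩ I) X (P ∩ ∁ H)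
                                                    (λ v∈ → x∈p∩q⁺ (∈P (p∩q⊆q L I v∈) (L≢h (p∩q⊆p L I v∈))
                                                                   , x∉p⇒x∈∁p (L#H (p∩q⊆p L I v∈))))
                                                    (λ v∈ → x∈p∩q⁺ (∈P (p∩q⊆p I (∁ (H ∪ L)) v∈) (∉H⇒≢h (proj₁ (X∉ v∈)))
                                                                   , x∉p⇒x∈∁p (proj₁ (X∉ v∈))))
                                                    (λ v∈ v∈X → proj₂ (X∉ v∈X) (p∩q⊆p L I v∈))) ⟩
                ∣ H∖h ∣ + ∣ P ∩ ∁ H ∣          ≤⟨ disjoint⇒∣p∣+∣q∣≤∣r∣ H∖h (P ∩ ∁ H) P H∖h⊆P (p∩q⊆p P (∁ H))
                                                    (λ v∈ v∈′ → x∈∁p⇒x∉p (p∩q⊆q P (∁ H) v∈′) (p∩q⊆p H (∁ ⁅ h ⁆) v∈)) ⟩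
                ∣ P ∣                          ≤⟨ ∣P∣≤p ⟩
                p                              ∎

              ∣H∖h∣<∣L∩∁I∣ : ∣ H∖h ∣ < ∣ L ∩ ∁ I ∣
              ∣H∖h∣<∣L∩∁I∣ = ℕ.+-cancelʳ-< (∣ L ∩ I ∣ + ∣ X ∣) _ _ (begin-strict
                ∣ H∖h ∣ + (∣ L ∩ I ∣ + ∣ X ∣)       ≤⟨ few ⟩
                p                                   <⟨ p<q ⟩
                q                                   ≤⟨ replaced-by-H L~z ⟩
                ∣ L ∪ X ∣                           ≤⟨ ∣p∪q∣≤∣p∣+∣q∣ L X ⟩
                ∣ L ∣ + ∣ X ∣                       ≡⟨ cong (_+ ∣ X ∣) (∣p∣≡∣p∩q∣+∣p∩∁q∣ L I) ⟩
                ∣ L ∩ I ∣ + ∣ L ∩ ∁ I ∣ + ∣ X ∣     ≡⟨ cong (_+ ∣ X ∣) (ℕ.+-comm ∣ L ∩ I ∣ ∣ L ∩ ∁ I ∣) ⟩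
                ∣ L ∩ ∁ I ∣ + ∣ L ∩ I ∣ + ∣ X ∣     ≡⟨ ℕ.+-assoc ∣ L ∩ ∁ I ∣ _ _ ⟩
                ∣ L ∩ ∁ I ∣ + (∣ L ∩ I ∣ + ∣ X ∣)   ∎)

            -- `L` moves to the far left, cut at the left end of `z`, and `H` goes inside `z`. The
            -- vertices of `L` that protrude in `γ` still do so, and `B` is chosen among them.
            exchange : (∀ {v} → v ∈ H → v ≢ h → Inside γ v z) → ¬ Right ρ L → Exchangeable
            exchange H-inside ¬right =
              placement , represents , L , L-lc , L#H , ¬right , leftmost , L~z ,
              B , p∩q⊆p L (∁ I) ∘ B⊆ , ∣B∣≡∣H∣ , noninside
              where
              L~z : ∀ {v} → v ∈ L → v ~ z
              L~z v∈L = Inside⇒~ ρ-rep _ _ (interior L-lc L#H ¬right v∈L)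

              B-choice = subsetOfSize (L ∩ ∁ I) (∣H∣≤∣L∩∁I∣ H-inside L~z)
              B        = proj₁ B-choice
              B⊆       = proj₁ (proj₂ B-choice)
              ∣B∣≡∣H∣  = proj₂ (proj₂ B-choice)

              open Rearrangement {ρK = γ} {ρD = point} {ρ = γ} (l γ z) L-lc H-lc L#H
                (restrict L≢h γ-rep) point-rep (restrict (∉H⇒≢h ∘ proj₂) γ-rep)
                (λ v∈L → meet γ-rep z≢h (L≢h v∈L) (~-sym (L~z v∈L))) L~z H~z z<others

              noninside : ∀ {v} → v ∈ B → ¬ Inside placement v z
              noninside v∈B ins with x∈p∩q⁻ L (∁ I) (B⊆ v∈B) | inside-cases ins
              ... | v∈L , v∉I | inj₁ (_ , z<v) =
                      -- `L` ends before `z` in `γ`, so starting after the left end of `z` would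
                      -- already mean being inside in `γ`.
                      x∈∁p⇒x∉p v∉I (∈I⁺ (ℕ.<⇒≤ z<v , ℕ.<⇒≤ (L<rz v∈L) , inj₁ z<v))
              ... | v∈L , _ | inj₂ (inj₁ v∈H) = L#H v∈L v∈H
              ... | v∈L , _ | inj₂ (inj₂ (v∉L , _)) = v∉L v∈L

      -- `K` shows that there are components besides `H`, and enough of them for the outermost ones
      -- in `γ`, `L` and `R`, to differ. At most one of these is rightmost in `ρ`; the other is
      -- exchanged.
      exchangeable : LocalComponent K → (∀ {v} → v ∈ K → v ∉ H) → ¬ Right ρ K → Exchangeable
      exchangeable {K} K-lc@((k , k∈K) , _) K#H ¬right-K with proj₁ H-lc
      ... | h , h∈H with deletion h (∈⇒≢z H-lc h∈H)
      ... | γ , γ-rep , γ-few = conclude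
        where
        γ-rep′ : Represents G (reflect γ) (_≢ h)
        γ-rep′ = Represents-reflect γ-rep

        module D  = Deleted h∈H γ-rep γ-few
        -- The mirror image of `γ` handles the rightmost component as a leftmost one.
        module D′ = Deleted h∈H γ-rep′ (λ P h∉P inside → γ-few P h∉P (Inside-reflect⁻ γ ∘ inside))

        -- Were `H` and `L` the only components, `K` would be `L`, with nothing but the leftmost `H`
        -- to be compared with.
        only-besides-H⇒Right : ∀ {L} → LocalComponent L → (∀ v → v ∉ L → v ∉ H → v ≢ z → ⊥₀) → Right ρ K
        only-besides-H⇒Right {L} L-lc exhausted u w u∈K w∉K w≢z with w ∈? H
        ... | yes w∈H = H-left w u w∈H (K#H u∈K) (∈⇒≢z K-lc u∈K)
        ... | no  w∉H = contradiction
                (meeting⇒⊆ L-lc K-lc (∈L (K#H u∈K) (∈⇒≢z K-lc u∈K)) u∈K (∈L w∉H w≢z)) w∉K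
          where
          ∈L : ∀ {v} → v ∉ H → v ≢ z → v ∈ L
          ∈L {v} v∉H v≢z = decidable-stable (v ∈? L) λ v∉L → exhausted v v∉L v∉H v≢z

        module Distinct {L R} (L-lc : LocalComponent L) (L#H : ∀ {v} → v ∈ L → v ∉ H)
          (L-leftmost : LeftmostBesidesH γ L)
          (R-lc : LocalComponent R) (R#H : ∀ {v} → v ∈ R → v ∉ H)
          (R-rightmost : LeftmostBesidesH (reflect γ) R) (L#R : ∀ {v} → v ∈ L → v ∉ R)
          where

          R#L : ∀ {v} → v ∈ R → v ∉ L
          R#L v∈R v∈L = L#R v∈L v∈R

          H-inside : ∀ {v} → v ∈ H → v ≢ h → Inside γ v z
          H-inside {v} v∈H v≢h = ℕ.<⇒≤ z<v , ℕ.<⇒≤ v<z , inj₁ z<v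
            where
            z<v : l γ z < l γ v
            z<v = ℕ.≰⇒> (D.not-left-of-z L-lc L#H L-leftmost R-lc R#H R#L v∈H v≢h)

            v<z : r γ v < r γ z
            v<z = ℕ.≰⇒> λ z≤v → D′.not-left-of-z R-lc R#H R-rightmost L-lc L#H L#R v∈H v≢h
              (ℕ.∸-monoʳ-≤ (bound γ) z≤v)

          conclude : Exchangeable
          conclude with Right? ρ L
          ... | no  ¬right-L = D.exchange L-lc L#H L-leftmost R-lc R#H R#L H-inside ¬right-L
          ... | yes right-L  = D′.exchange R-lc R#H R-rightmost L-lc L#H L#R
                  (λ v∈H v≢h → Inside-reflect⁺ γ (H-inside v∈H v≢h)) ¬right-R
            where
            ¬right-R : ¬ Right ρ R
            ¬right-R right-R with proj₁ L-lc | proj₁ R-lc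
            ... | u , u∈L | w , w∈R = ℕ.<-asym
                    (ℕ.<-≤-trans (right-L u w u∈L (R#L w∈R) (∈⇒≢z R-lc w∈R)) (l≤r ρ u))
                    (ℕ.<-≤-trans (right-R w u w∈R (L#R u∈L) (∈⇒≢z L-lc u∈L)) (l≤r ρ w))

        conclude : Exchangeable
        conclude with D.leftmostBesidesH (k , K#H k∈K , ∈⇒≢z K-lc k∈K)
                    | D′.leftmostBesidesH (k , K#H k∈K , ∈⇒≢z K-lc k∈K)
        ... | L , L-lc , L#H , L-leftmost | R , R-lc , R#H , R-rightmost
          with any? (λ v → ¬? (v ∈? L) ×-dec ¬? (v ∈? H) ×-dec ¬? (v ≟ z))
        ... | no ∄ = contradiction
                (only-besides-H⇒Right L-lc λ v v∉L v∉H v≢z → ∄ (v , v∉L , v∉H , v≢z)) ¬right-K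
        ... | yes (v , v∉L , v∉H , v≢z) =
                Distinct.conclude L-lc L#H L-leftmost R-lc R#H R-rightmost L#R
          where
          -- A common vertex `t` would lie both before and after the remaining vertex `v`.
          L#R : ∀ {t} → t ∈ L → t ∉ R
          L#R {t} t∈L t∈R = ℕ.<-asym
            (ℕ.≤-<-trans (l≤r γ t) (L-leftmost t v t∈L v∉L v∉H v≢z))
            (ℕ.≤-<-trans (l≤r γ v) (reflect-before⁻ γ (R-rightmost t v t∈R
              (λ v∈R → v∉L (meeting⇒⊆ R-lc L-lc t∈R t∈L v∈R)) v∉H v≢z)))

-- Deleting one vertex.

record Deletion (h : Fin n) : Set where
  field
    {size}  : ℕ
    size<n  : size < n
    embed   : Fin size ↣ Fin n
  open Injection embed public using (to; injective)
  field
    retract : ∀ {v} → v ≢ h → ∃[ i ] to i ≡ v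
    card    : ∀ p q → h ∉ p → (∀ i → to i ∈ p → i ∈ q) → ∣ p ∣ ≤ ∣ q ∣

-- The record keeps the successor form of `n` out of sight, so that it can be used with the order of
-- an arbitrary graph.
delete : (h : Fin n) → Deletion h
delete {suc m} h = record
  { size<n  = ℕ.≤-refl
  ; embed   = mk↣ {to = punchIn h} (punchIn-injective h _ _)
  ; retract = λ v≢h → punchOut (v≢h ∘ sym) , punchIn-punchOut (v≢h ∘ sym)
  ; card    = ∣∣-punchIn h
  }

module Extension (G : Graph) {h : Vertex G} (d : Deletion h) (ρ : Placement (Deletion.size d)) where
  open Graph G hiding (Vertex; VertexSet)
  open Deletion d

  private
    lo hi : ∀ {v} → Dec (v ≡ h) → ℕ
    -- A dummy value: the interval of `h` is meaningless, and `Represents-extension` excludes `h`.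
    lo (yes _)   = 0
    lo (no v≢h)  = l ρ (proj₁ (retract v≢h))
    hi (yes _)   = 0
    hi (no v≢h)  = r ρ (proj₁ (retract v≢h))

    lo≤hi : ∀ {v} (e : Dec (v ≡ h)) → lo e ≤ hi e
    lo≤hi (yes _)  = z≤n
    lo≤hi (no v≢h) = l≤r ρ _

    hi≤bound : ∀ {v} (e : Dec (v ≡ h)) → hi e ≤ bound ρ
    hi≤bound (yes _)  = z≤n
    hi≤bound (no v≢h) = r≤bound ρ _

  extension : Placement order
  extension = record
    { l       = λ v → lo (v ≟ h)
    ; r       = λ v → hi (v ≟ h)
    ; l≤r     = λ v → lo≤hi (v ≟ h)
    ; bound   = bound ρ
    ; r≤bound = λ v → hi≤bound (v ≟ h)
    }

  l-to : ∀ {i v} → to i ≡ v → v ≢ h → l extension v ≡ l ρ i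
  l-to {i} {v} toi≡v v≢h with v ≟ h
  ... | yes v≡h = contradiction v≡h v≢h
  ... | no  v≢h = cong (l ρ) (injective (trans (proj₂ (retract v≢h)) (sym toi≡v)))

  r-to : ∀ {i v} → to i ≡ v → v ≢ h → r extension v ≡ r ρ i
  r-to {i} {v} toi≡v v≢h with v ≟ h
  ... | yes v≡h = contradiction v≡h v≢h
  ... | no  v≢h = cong (r ρ) (injective (trans (proj₂ (retract v≢h)) (sym toi≡v)))

  Inside-extension⁻ : ∀ {i j v w} → to i ≡ v → to j ≡ w → v ≢ h → w ≢ h → Inside extension v w → Inside ρ i j
  Inside-extension⁻ i≡v j≡w v≢h w≢h ins
    rewrite l-to i≡v v≢h | r-to i≡v v≢h | l-to j≡w w≢h | r-to j≡w w≢h = ins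

  Represents-extension : Represents (induced G embed) ρ U → Represents G extension (_≢ h)
  Represents-extension rep = record
    { meet = λ {v} {w} v≢h w≢h v~w → let (i , i≡v) = retract v≢h ; (j , j≡w) = retract w≢h in
        subst₂ _≤_ (sym (l-to i≡v v≢h)) (sym (r-to j≡w w≢h))
          (meet rep {i} {j} _ _ (subst₂ _~_ (sym i≡v) (sym j≡w) v~w))
    ; sep  = λ {v} {w} v≢h w≢h v≢w v≁w → let (i , i≡v) = retract v≢h ; (j , j≡w) = retract w≢h in
        Sum.map (subst₂ _<_ (sym (r-to i≡v v≢h)) (sym (l-to j≡w w≢h)))
                (subst₂ _<_ (sym (r-to j≡w w≢h)) (sym (l-to i≡v v≢h)))
          (sep rep {i} {j} _ _ (λ i≡j → v≢w (trans (sym i≡v) (trans (cong to i≡j) j≡w)))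
            (v≁w ∘ subst₂ _~_ i≡v j≡w))
    }

-- Passing between intervals of the line and placements.

module Transfer {c ℓ₁ ℓ₂} (ℝ : Line c ℓ₁ ℓ₂) where
  open Line ℝ
  open Impropriety ℝ
  open Interval
  private module O = StrictTotalOrder strictTotalOrder

  ≮⇒≥ᴸ : ∀ {x y} → ¬ x <ᴸ y → y ≤ᴸ x
  ≮⇒≥ᴸ {x} {y} x≮y with O.compare x y
  ... | tri< x<y _ _ = contradiction x<y x≮y
  ... | tri≈ _ x≈y _ = inj₂ (O.Eq.sym x≈y)
  ... | tri> _ _ y<x = inj₁ y<x

  ≤-<-transᴸ : ∀ {x y w} → x ≤ᴸ y → y <ᴸ w → x <ᴸ w
  ≤-<-transᴸ (inj₁ x<y) y<w = O.trans x<y y<w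
  ≤-<-transᴸ (inj₂ x≈y) y<w = proj₂ O.<-resp-≈ (O.Eq.sym x≈y) y<w

  ≤⇒≯ᴸ : ∀ {x y} → x ≤ᴸ y → ¬ y <ᴸ x
  ≤⇒≯ᴸ x≤y y<x = O.irrefl O.Eq.refl (≤-<-transᴸ x≤y y<x)

  <-≤-transᴸ : ∀ {x y w} → x <ᴸ y → y ≤ᴸ w → x <ᴸ w
  <-≤-transᴸ x<y (inj₁ y<w) = O.trans x<y y<w
  <-≤-transᴸ x<y (inj₂ y≈w) = proj₁ O.<-resp-≈ y≈w x<y

  data End : Set where
    lo hi : End

  endᴵ : Interval → End → Carrier
  endᴵ I lo = lower I
  endᴵ I hi = upper I

  endᴾ : Placement n → Fin n → End → ℕ
  endᴾ ρ v lo = l ρ v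
  endᴾ ρ v hi = r ρ v

  -- Strict comparisons suffice: by trichotomy the weak ones are negations of reversed strict ones.
  SameOrder : (Fin n → Interval) → Placement n → Set ℓ₂
  SameOrder is ρ = ∀ v e w f → endᴵ (is v) e <ᴸ endᴵ (is w) f ⇔ endᴾ ρ v e < endᴾ ρ w f

  module _ (is : Fin n → Interval) where

    private
      below : End → Carrier → Subset n
      below e x = fromDec (λ v → endᴵ (is v) e O.<? x)

      -- The number of endpoints strictly below the point, left and right ends counted separately.
      rank : Carrier → ℕ
      rank x = ∣ below lo x ∣ + ∣ below hi x ∣

      below-⊆ : ∀ e {x y} → x ≤ᴸ y → below e x ⊆ below e y
      below-⊆ e x≤y v∈ = ∈-fromDec⁺ (λ v → endᴵ (is v) e O.<? _)
        (<-≤-transᴸ (∈-fromDec⁻ (λ v → endᴵ (is v) e O.<? _) v∈) x≤y)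

      rank-mono : ∀ {x y} → x ≤ᴸ y → rank x ≤ rank y
      rank-mono x≤y = ℕ.+-mono-≤ (p⊆q⇒∣p∣≤∣q∣ (below-⊆ lo x≤y)) (p⊆q⇒∣p∣≤∣q∣ (below-⊆ hi x≤y))

      below-< : ∀ v e {y} → endᴵ (is v) e <ᴸ y → ∣ below e (endᴵ (is v) e) ∣ < ∣ below e y ∣
      below-< v e x<y = p⊂q⇒∣p∣<∣q∣ (below-⊆ e (inj₁ x<y) , v ,
        ∈-fromDec⁺ (λ v → endᴵ (is v) e O.<? _) x<y ,
        λ v∈ → O.irrefl O.Eq.refl (∈-fromDec⁻ (λ v → endᴵ (is v) e O.<? _) v∈))

      -- The smaller point is itself an endpoint, counted below `y` but not below itself.
      rank-< : ∀ v e {y} → endᴵ (is v) e <ᴸ y → rank (endᴵ (is v) e) < rank y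
      rank-< v lo x<y = ℕ.+-mono-<-≤ (below-< v lo x<y) (p⊆q⇒∣p∣≤∣q∣ (below-⊆ hi (inj₁ x<y)))
      rank-< v hi x<y = ℕ.+-mono-≤-< (p⊆q⇒∣p∣≤∣q∣ (below-⊆ lo (inj₁ x<y))) (below-< v hi x<y)

    ranks : Placement n
    ranks = record
      { l       = λ v → rank (lower (is v))
      ; r       = λ v → rank (upper (is v))
      ; l≤r     = λ v → rank-mono (lower≤upper (is v))
      ; bound   = n + n
      ; r≤bound = λ v → ℕ.+-mono-≤ (∣p∣≤n (below lo (upper (is v)))) (∣p∣≤n (below hi (upper (is v))))
      }

    ranks-SameOrder : SameOrder is ranks
    ranks-SameOrder v e w f = mk⇔
      (subst₂ _<_ (ends v e) (ends w f) ∘ rank-< v e)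
      (λ rank< → decidable-stable (endᴵ (is v) e O.<? endᴵ (is w) f) λ x≮y →
        ℕ.<⇒≱ rank< (subst₂ _≤_ (ends w f) (ends v e) (rank-mono (≮⇒≥ᴸ x≮y))))
      where
      ends : ∀ v e → rank (endᴵ (is v) e) ≡ endᴾ ranks v e
      ends v lo = refl
      ends v hi = refl

  module _ (origin : Carrier) (ρ : Placement n) where

    private
      -- An increasing sequence of points of the line, obtained by iterating `noMaximum`.
      mark : ℕ → Carrier
      mark zero    = origin
      mark (suc k) = proj₁ (noMaximum (mark k))

      mark-< : ∀ {j k} → j < k → mark j <ᴸ mark k
      mark-< {j} {suc k} (s≤s j≤k) with ℕ.m≤n⇒m<n∨m≡n j≤k
      ... | inj₁ j<k  = O.trans (mark-< j<k) (proj₂ (noMaximum (mark k)))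
      ... | inj₂ refl = proj₂ (noMaximum (mark k))

      mark-≤ : ∀ {j k} → j ≤ k → mark j ≤ᴸ mark k
      mark-≤ {j} {k} j≤k with ℕ.m≤n⇒m<n∨m≡n j≤k
      ... | inj₁ j<k  = inj₁ (mark-< j<k)
      ... | inj₂ refl = inj₂ O.Eq.refl

    marked : Fin n → Interval
    marked v = record
      { lower = mark (l ρ v) ; upper = mark (r ρ v) ; lower≤upper = mark-≤ (l≤r ρ v) }

    private
      ends : ∀ v e → endᴵ (marked v) e ≡ mark (endᴾ ρ v e)
      ends v lo = refl
      ends v hi = refl

    marked-SameOrder : SameOrder marked ρ
    marked-SameOrder v e w f rewrite ends v e | ends w f =
      mk⇔ (λ x<y → ℕ.≰⇒> λ k≤j → ≤⇒≯ᴸ (mark-≤ k≤j) x<y) mark-<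

  module _ {is : Fin n → Interval} {ρ : Placement n} (same : SameOrder is ρ) where

    ≤⇒ᴾ : ∀ v e w f → endᴵ (is v) e ≤ᴸ endᴵ (is w) f → endᴾ ρ v e ≤ endᴾ ρ w f
    ≤⇒ᴾ v e w f x≤y = ℕ.≮⇒≥ (≤⇒≯ᴸ x≤y ∘ Equivalence.from (same w f v e))

    ≤⇒ᴸ : ∀ v e w f → endᴾ ρ v e ≤ endᴾ ρ w f → endᴵ (is v) e ≤ᴸ endᴵ (is w) f
    ≤⇒ᴸ v e w f x≤y = ≮⇒≥ᴸ (λ y<x → ℕ.<⇒≱ (Equivalence.to (same w f v e) y<x) x≤y)

    ≬⇒ : ∀ {v w} → is v ≬ᴵ is w → l ρ v ≤ r ρ w
    ≬⇒ {v} {w} (_ , (lv≤x , _) , (_ , x≤rw)) = ≤⇒ᴾ v lo w hi (≤ᴸ-trans lv≤x x≤rw)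

    ≬⇐ : ∀ {v w} → l ρ v ≤ r ρ w → l ρ w ≤ r ρ v → is v ≬ᴵ is w
    -- The larger of the two left ends is the common point.
    ≬⇐ {v} {w} lv≤rw lw≤rv with ℕ.≤-total (l ρ v) (l ρ w)
    ... | inj₁ lv≤lw = lower (is w) , (≤⇒ᴸ v lo w lo lv≤lw , ≤⇒ᴸ w lo v hi lw≤rv) , (≤ᴸ-refl , lower≤upper (is w))
    ... | inj₂ lw≤lv = lower (is v) , (≤ᴸ-refl , lower≤upper (is v)) , (≤⇒ᴸ w lo v lo lw≤lv , ≤⇒ᴸ v lo w hi lv≤rw)

    ⊂⇒Inside : ∀ {v w} → is v ⊂ᴵ is w → Inside ρ v w
    ⊂⇒Inside {v} {w} (v⊆w , w⊈v) = lw≤lv , rv≤rw , strict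
      where
      lw≤lv : l ρ w ≤ l ρ v
      lw≤lv = ≤⇒ᴾ w lo v lo (proj₁ (v⊆w (≤ᴸ-refl , lower≤upper (is v))))
      rv≤rw : r ρ v ≤ r ρ w
      rv≤rw = ≤⇒ᴾ v hi w hi (proj₂ (v⊆w (lower≤upper (is v) , ≤ᴸ-refl)))
      strict : l ρ w < l ρ v ⊎ r ρ v < r ρ w
      strict with l ρ w ℕ.<? l ρ v | r ρ v ℕ.<? r ρ w
      ... | yes lw<lv | _         = inj₁ lw<lv
      ... | no  _     | yes rv<rw = inj₂ rv<rw
      ... | no  lw≮lv | no  rv≮rw = ⊥-elim (w⊈v
              (λ (lw≤x , x≤rw) → ≤ᴸ-trans (≤⇒ᴸ v lo w lo (ℕ.≮⇒≥ lw≮lv)) lw≤x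
                               , ≤ᴸ-trans x≤rw (≤⇒ᴸ w hi v hi (ℕ.≮⇒≥ rv≮rw))))

    Inside⇒⊂ : ∀ {v w} → Inside ρ v w → is v ⊂ᴵ is w
    Inside⇒⊂ {v} {w} (lw≤lv , rv≤rw , strict) =
      (λ (lv≤x , x≤rv) → ≤ᴸ-trans (≤⇒ᴸ w lo v lo lw≤lv) lv≤x , ≤ᴸ-trans x≤rv (≤⇒ᴸ v hi w hi rv≤rw)) ,
      λ w⊆v → [ (λ lw<lv → ℕ.<⇒≱ lw<lv (≤⇒ᴾ v lo w lo (proj₁ (w⊆v (≤ᴸ-refl , lower≤upper (is w))))))
              , (λ rv<rw → ℕ.<⇒≱ rv<rw (≤⇒ᴾ w hi v hi (proj₂ (w⊆v (lower≤upper (is w) , ≤ᴸ-refl))))) ]′ strict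

  Represents⁺ : ∀ {G} (α : Representation G) {ρ} → SameOrder (interval α) ρ → Represents G ρ U
  Represents⁺ {G} α {ρ} same = record
    { meet = λ {v} {w} _ _ v~w → ≬⇒ same (Equivalence.to (α.represents λ { refl → ~-irr v~w }) v~w)
    ; sep  = λ {v} {w} _ _ v≢w v≁w → separate v w (v≁w ∘ Equivalence.from (α.represents v≢w))
    }
    where
    open Graph G using (~-irr)
    module α = Representation α
    separate : ∀ v w → ¬ (interval α v ≬ᴵ interval α w) → r ρ v < l ρ w ⊎ r ρ w < l ρ v
    separate v w disjoint with r ρ v ℕ.<? l ρ w | r ρ w ℕ.<? l ρ v
    ... | yes rv<lw | _         = inj₁ rv<lw
    ... | no  _     | yes rw<lv = inj₂ rw<lv
    ... | no  rv≮lw | no  rw≮lv = contradiction (≬⇐ same (ℕ.≮⇒≥ rw≮lv) (ℕ.≮⇒≥ rv≮lw)) disjoint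

  representation : Carrier → ∀ {G ρ} → Represents G ρ U → Representation G
  representation origin {G} {ρ} rep = record
    { interval   = marked origin ρ
    ; represents = λ {v} {w} v≢w → mk⇔
        (λ v~w → ≬⇐ same (meet rep _ _ v~w) (meet rep _ _ (~-sym v~w)))
        (λ v≬w → decidable-stable (v ~? w) λ v≁w →
          [ (λ rv<lw → ℕ.<⇒≱ rv<lw (≬⇒ same (let (x , v∋x , w∋x) = v≬w in x , w∋x , v∋x)))
          , (λ rw<lv → ℕ.<⇒≱ rw<lv (≬⇒ same v≬w)) ]′ (sep rep _ _ v≢w v≁w))
    }
    where
    open Graph G using (_~?_; ~-sym)
    same = marked-SameOrder origin ρ

  module _ {G : Graph} {z : Vertex G} where
    open Graph G hiding (Vertex; VertexSet)
    open LocalComponents G z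

    module _ (α : Representation G) {ρ : Placement order} (same : SameOrder (interval α) ρ) where

      private
        before⇒leftOf : ∀ {K L} → (∀ {u w} → u ∈ K → w ∈ L → r ρ u < l ρ w) → _leftOf_ G z α K L
        before⇒leftOf K<L (u , u∈K , _ , x≤u) (w , w∈L , w≤y , _) =
          <-≤-transᴸ (≤-<-transᴸ x≤u (Equivalence.from (same u hi w lo) (K<L u∈K w∈L))) w≤y

        leftOf⇒before : ∀ {K L} → _leftOf_ G z α K L → ∀ {u w} → u ∈ K → w ∈ L → r ρ u < l ρ w
        leftOf⇒before K<L {u} {w} u∈K w∈L = Equivalence.to (same u hi w lo)
          (K<L (u , u∈K , lower≤upper (interval α u) , ≤ᴸ-refl)
               (w , w∈L , ≤ᴸ-refl , lower≤upper (interval α w)))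

        beyond : ∀ {K L} → LocalComponent K → LocalComponent L → L ≢ K → ∀ {v} → v ∈ L → v ∉ K × v ≢ z
        beyond K-lc L-lc L≢K v∈L = ≢⇒disjoint L-lc K-lc L≢K v∈L , ∈⇒≢z L-lc v∈L

      Left⇒IsLeftmost : ∀ {K} → LocalComponent K → Left ρ K → IsLeftmost G z α K
      Left⇒IsLeftmost K-lc left L L-lc L≢K = before⇒leftOf λ u∈K w∈L →
        let (w∉K , w≢z) = beyond K-lc L-lc L≢K w∈L in left _ _ u∈K w∉K w≢z

      Right⇒IsRightmost : ∀ {K} → LocalComponent K → Right ρ K → IsRightmost G z α K
      Right⇒IsRightmost K-lc right L L-lc L≢K = before⇒leftOf λ w∈L u∈K →
        let (w∉K , w≢z) = beyond K-lc L-lc L≢K w∈L in right _ _ u∈K w∉K w≢z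

      IsLeftmost⇒Left : ∀ {K} → IsLeftmost G z α K → Left ρ K
      IsLeftmost⇒Left leftmost u w u∈K w∉K w≢z with component w w≢z
      ... | W , W-lc , w∈W = leftOf⇒before (leftmost W W-lc λ { refl → w∉K w∈W }) u∈K w∈W

      IsRightmost⇒Right : ∀ {K} → IsRightmost G z α K → Right ρ K
      IsRightmost⇒Right rightmost u w u∈K w∉K w≢z with component w w≢z
      ... | W , W-lc , w∈W = leftOf⇒before (rightmost W W-lc λ { refl → w∉K w∈W }) w∈W u∈K

      ∣contained∣≤∣insiders∣ : ∣ contained α z ∣ ≤ ∣ insiders ρ z ∣
      ∣contained∣≤∣insiders∣ = p⊆q⇒∣p∣≤∣q∣ λ v∈ → ∈-fromDec⁺ (λ v → inside? ρ v z)
        (⊂⇒Inside same (∈-fromDec⁻ (λ v → interval α v ⊂ᴵ? interval α z) v∈))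

      ∣insiders∣≤∣contained∣ : ∣ insiders ρ z ∣ ≤ ∣ contained α z ∣
      ∣insiders∣≤∣contained∣ = p⊆q⇒∣p∣≤∣q∣ λ v∈ → ∈-fromDec⁺ (λ v → interval α v ⊂ᴵ? interval α z)
        (Inside⇒⊂ same (∈-fromDec⁻ (λ v → inside? ρ v z) v∈))

    -- Walks from `z` of length 0 or 1 end in `z` or in a neighbour of `z`, so a vertex of `H` not
    -- adjacent to `z` would be exterior.
    ¬exterior⇒~ : ∀ {H} → LocalComponent H → ¬ IsExterior G z H → ∀ {v} → v ∈ H → v ~ z
    ¬exterior⇒~ H-lc nonexterior {v} v∈H = decidable-stable (v ~? z) λ v≁z →
      nonexterior (v , v∈H , far v≁z)
      where
      far : ¬ v ~ z → IsExteriorVertex G z v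
      far _   stay                  = contradiction refl (∈⇒≢z H-lc v∈H)
      far v≁z (step z~v stay)       = contradiction (~-sym z~v) v≁z
      far _   (step _ (step _ _))   = s≤s (s≤s z≤n)

  ∣contained∣≤maxContained : ∀ {G} (α : Representation G) v → ∣ contained α v ∣ ≤ maxContained α
  ∣contained∣≤maxContained {G} α v = lookup (xs≤max 0 (map f (allFin _))) (∈-map⁺ f (∈-allFin v))
    where
    f : Vertex G → ℕ
    f v = ∣ contained α v ∣

  -- The clique and the maximal order for interval representations.

  module Main {p : ℕ} {G : Graph} {z : Vertex G} (forbidden : IsMinimalForbidden p G)
    (z-basepoint : IsBasepoint G z) (α : Representation G) (α-minimal : IsMinimalRepresentation α)
    where
    open Graph G hiding (Vertex; VertexSet)
    open LocalComponents G z

    q : ℕ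
    q = proj₁ z-basepoint

    p<q : p < q
    p<q = ℕ.≰⇒> λ q≤p → let (β , contained≤q) = proj₁ (proj₁ (proj₂ z-basepoint)) in
      proj₁ (proj₂ forbidden) (β , λ v → ℕ.≤-trans (contained≤q v) q≤p)

    ρ : Placement order
    ρ = ranks (interval α)

    same : SameOrder (interval α) ρ
    same = ranks-SameOrder (interval α)

    origin : Carrier
    origin = lower (interval α z)

    basepoint : ∀ ν → Represents G ν U → q ≤ ∣ insiders ν z ∣
    basepoint ν ν-rep = ℕ.≤-trans (proj₂ (proj₂ z-basepoint) β)
      (∣contained∣≤∣insiders∣ β (marked-SameOrder origin ν))
      where
      β : Representation G
      β = representation origin ν-rep

    -- Minimality makes the graph without `h` `p`-improper. Its representation is extended by a
    -- dummy interval for `h`, so only sets avoiding `h` are counted.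
    deletion : ∀ h → h ≢ z → Σ[ γ ∈ Placement order ] Represents G γ (_≢ h) ×
                 (∀ P → h ∉ P → (∀ {v} → v ∈ P → Inside γ v z) → ∣ P ∣ ≤ p)
    deletion h h≢z with delete h
    ... | d with proj₂ (proj₂ forbidden) (Deletion.embed d) (Deletion.size<n d) | Deletion.retract d (h≢z ∘ sym)
    ... | γ , γ-few | z′ , z′≡z = extension , Represents-extension (Represents⁺ γ γ-same) , few
      where
      γ-same = ranks-SameOrder (interval γ)
      open Extension G d (ranks (interval γ))
      open Deletion d using (card; to)

      few : ∀ P → h ∉ P → (∀ {v} → v ∈ P → Inside extension v z) → ∣ P ∣ ≤ p
      few P h∉P P-inside = ℕ.≤-trans (card P (contained γ z′) h∉P inside′) (γ-few z′)
        where
        inside′ : ∀ i → to i ∈ P → i ∈ contained γ z′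
        inside′ i i∈P = ∈-fromDec⁺ (λ i → interval γ i ⊂ᴵ? interval γ z′) (Inside⇒⊂ γ-same
          (Inside-extension⁻ refl z′≡z (λ i≡h → h∉P (subst (_∈ P) i≡h i∈P)) (h≢z ∘ sym) (P-inside i∈P)))

    open Minimal p q p<q basepoint deletion

    -- As `α` is minimal, `maxContained α` is the impropriety, which is at most `q` because `G` is
    -- `q`-improper.
    ∣insiders∣≤q : ∣ insiders ρ z ∣ ≤ q
    ∣insiders∣≤q = ℕ.≤-trans (∣insiders∣≤∣contained∣ α same) (ℕ.≤-trans (∣contained∣≤maxContained α z)
      (proj₂ α-minimal q (proj₁ (proj₁ (proj₂ z-basepoint)))))

    module _ {H : VertexSet G} (H-lc : LocalComponent H) (H~z : ∀ {v} → v ∈ H → v ~ z)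
             (H-clique : IsClique G H) where

      -- `ρ` is the placement of `α` or its mirror image, whichever has `H` on the left. The last
      -- two hypotheses translate between `Right ρ` and the side components of `α`.
      module _ {ρ : Placement order} (ρ-rep : Represents G ρ U) (few : ∣ insiders ρ z ∣ ≤ q)
        (H-left : Left ρ H) (H-side : IsSideComponent G z α H)
        (¬side⇒¬right : ∀ {K} → LocalComponent K → ¬ IsSideComponent G z α K → ¬ Right ρ K)
        (¬right⇒¬side : ∀ {K} → LocalComponent K → (∀ {v} → v ∈ K → v ∉ H) → ¬ Right ρ K →
                        ¬ IsSideComponent G z α K)
        where
        open SideComponent ρ-rep few H-lc H~z H-clique H-left

        private
          nonside#H : ∀ {K} → LocalComponent K → ¬ IsSideComponent G z α K → ∀ {v} → v ∈ K → v ∉ H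
          nonside#H K-lc ¬side = ≢⇒disjoint K-lc H-lc λ { refl → ¬side H-side }

          ∣B∣≤∣H∣ : ∀ {B} → IsInteriorPotentialBlockingSet G z α B → ∣ B ∣ ≤ ∣ H ∣
          ∣B∣≤∣H∣ ((β , blocking) , K , (_ , K-lc , _) , ¬side , B⊆K) =
            noncontributing≤ K-lc (nonside#H K-lc ¬side) (¬side⇒¬right K-lc ¬side) B⊆K
              (Represents⁺ β β-same) λ v∈B ins → proj₁ (proj₂ (blocking v∈B)) (Inside⇒⊂ β-same ins)
            where β-same = ranks-SameOrder (interval β)

          blocking-set : Exchangeable → ∃[ B ] IsInteriorPotentialBlockingSet G z α B × ∣ B ∣ ≡ ∣ H ∣
          blocking-set (ν , ν-rep , L , L-lc , L#H , ¬right , L-left , L~z , B , B⊆L , ∣B∣≡∣H∣ , noninside) =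
            B , ((β , blocking) , L , (β , L-lc , inj₁ (Left⇒IsLeftmost β β-same L-lc L-left)) ,
                 ¬right⇒¬side L-lc L#H ¬right , B⊆L) , ∣B∣≡∣H∣
            where
            β : Representation G
            β = representation origin ν-rep

            β-same : SameOrder (interval β) ν
            β-same = marked-SameOrder origin ν

            -- A neighbour of `v` is `z` or belongs to `L`, all of which is adjacent to `z`; its
            -- distance from `z` is thus at most 1.
            not-near-exterior : ∀ {v w} → v ∈ L → IsExteriorVertex G z w → ¬ v ~ w
            not-near-exterior {v} {w} v∈L exterior v~w with w ≟ z
            ... | yes refl = contradiction (exterior stay) λ ()
            ... | no  w≢z  = contradiction
                    (exterior (step (~-sym (L~z (closed L-lc v∈L w≢z v~w))) stay)) λ { (s≤s ()) }

            blocking : IsBlockingSet G z β B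
            blocking v∈B = L~z (B⊆L v∈B) , noninside v∈B ∘ ⊂⇒Inside β-same , not-near-exterior (B⊆L v∈B)

          -- From the given set only its component `K` is taken; the set of maximal order may lie in
          -- another component.
          attained : ∃ (IsInteriorPotentialBlockingSet G z α) →
                     ∃[ B ] IsInteriorPotentialBlockingSet G z α B × ∣ B ∣ ≡ ∣ H ∣
          attained (_ , _ , K , (_ , K-lc , _) , ¬side , _) =
            blocking-set (exchangeable K-lc (nonside#H K-lc ¬side) (¬side⇒¬right K-lc ¬side))

        maximal-order : HasMaximalOrderAmong ∣ H ∣ (IsInteriorPotentialBlockingSet G z α)
        maximal-order = ∣B∣≤∣H∣ , attained

      side-has-maximal-order : IsSideComponent G z α H →
                               HasMaximalOrderAmong ∣ H ∣ (IsInteriorPotentialBlockingSet G z α)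
      side-has-maximal-order side@(_ , inj₁ leftmost) =
        maximal-order {ρ} (Represents⁺ α same) ∣insiders∣≤q H-left side
          (λ K-lc ¬side right → ¬side (K-lc , inj₂ (Right⇒IsRightmost α same K-lc right)))
          λ { K-lc K#H ¬right (_ , inj₁ left) →
                Left-disjoint ρ H-lc K-lc K#H H-left (IsLeftmost⇒Left α same left)
            ; _ _ ¬right (_ , inj₂ right) → ¬right (IsRightmost⇒Right α same right) }
        where
        H-left : Left ρ H
        H-left = IsLeftmost⇒Left α same leftmost
      side-has-maximal-order side@(_ , inj₂ rightmost) =
        maximal-order {reflect ρ} (Represents-reflect (Represents⁺ α same))
          (ℕ.≤-trans (∣insiders-reflect∣≤ ρ) ∣insiders∣≤q) (Right⇒Left-reflect ρ H-right) side
          (λ K-lc ¬side right → ¬side (K-lc , inj₁ (Left⇒IsLeftmost α same K-lc (Right-reflect⇒Left ρ right))))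
          λ { _ _ ¬right (_ , inj₁ left) → ¬right (Left⇒Right-reflect ρ (IsLeftmost⇒Left α same left))
            ; K-lc K#H ¬right (_ , inj₂ right) →
                Right-disjoint ρ H-lc K-lc K#H H-right (IsRightmost⇒Right α same right) }
        where
        H-right : Right ρ H
        H-right = IsRightmost⇒Right α same rightmost

    unconfined⇒clique : ∀ {H} → LocalComponent H → (∀ {v} → v ∈ H → v ~ z) →
                        IsUnconfined G z H → IsClique G H
    unconfined⇒clique H-lc H~z (_ , β , noncontributing) =
      all-outside⇒clique (Represents⁺ β β-same) H-lc H~z λ v∈H → noncontributing v∈H ∘ Inside⇒⊂ β-same
      where β-same = ranks-SameOrder (interval β)

theorem7 : ∀ {c ℓ₁ ℓ₂} (ℝ : Line c ℓ₁ ℓ₂) → let open Impropriety ℝ in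
    (p : ℕ) (G : Graph) → IsMinimalForbidden p G →
    (z : Vertex G) → IsBasepoint G z →
    (α : Representation G) → IsMinimalRepresentation α →
    (H : VertexSet G) → IsSideComponent G z α H → IsUnconfined G z H → ¬ IsExterior G z H →
    IsClique G H × HasMaximalOrderAmong ∣ H ∣ (IsInteriorPotentialBlockingSet G z α)
theorem7 ℝ p G forbidden z z-basepoint α α-minimal H side@(H-lc , _) unconfined nonexterior =
  clique , side-has-maximal-order H-lc H~z clique side
  where
  open Transfer ℝ
  open Main forbidden z-basepoint α α-minimal

  H~z = ¬exterior⇒~ H-lc nonexterior
  clique = unconfined⇒clique H-lc H~z unconfined
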